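{- Let $G$ be an $n$-vertex connected graph with diameter $3$, where $n\ge 7$. Then $m_G[0,n-3)\ge 2$. Equality holds if $G\cong G_{n,3,2}$ or $G\cong G_{n,3,2,a}$ for some integer $a$ with $1\le a\le n-5$.
   Context: All graphs are simple and finite. The signless Laplacian matrix of a graph $G$ is $Q(G)=D(G)+A(G)$, where $D(G)$ is the diagonal matrix of vertex degrees and $A(G)$ is the adjacency matrix; its eigenvalues are the signless Laplacian eigenvalues of $G$. For an $n$-vertex graph $G$ they are all real and lie in $[0,2n-2]$. For a real interval $I$, $m_GI$ denotes the number of signless Laplacian eigenvalues of $G$ lying in $I$, counted with multiplicity. $P_n$ and $K_n$ denote the path and the complete graph on $n$ vertices. For integers $n,d,t$ with $2\le d\le n-2$ and $2\le t\le d$, $G_{n,d,t}$ is the graph obtained from the vertex-disjoint union of the path $P_{d+1}=v_1\dots v_{d+1}$ and $K_{n-d-1}$ by adding all edges between the vertices of $K_{n-d-1}$ and the vertices $v_{t-1},v_t,v_{t+1}$. For integers $n,d,r,a$ with $3\le d\le n-2$, $2\le r\le d-1$ and $1\le a\le n-d-2$, $G_{n,d,r,a}$ is the graph obtained from the vertex-disjoint union of the path $P_{d+1}=v_1\dots v_{d+1}$ and $K_{n-d-1}$ by adding all edges between $a$ chosen vertices of $K_{n-d-1}$ and the vertices $v_{r-1},v_r,v_{r+1}$, and all edges between the remaining $n-d-1-a$ vertices of $K_{n-d-1}$ and the vertices $v_r,v_{r+1},v_{r+2}$. -}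

module Defs where

open import Algebra.Bundles using (CommutativeRing)
open import Data.Bool using (Bool; true; false; T; not; _∨_; if_then_else_)
open import Data.Bool.Properties using (∨-comm)
open import Data.Fin using (Fin; zero; suc; toℕ; punchIn)
open import Data.Fin.Properties using (_≟_)
open import Data.Fin.Subset using (∣_∣)
open import Data.Nat as ℕ using (ℕ; zero; suc; _≡ᵇ_; _<ᵇ_; _∸_)
open import Data.Product using (_×_; ∃; ∃₂; _,_)
open import Data.Sum using (_⊎_; inj₁; inj₂)
open import Data.Vec using (Vec; tabulate; map; foldr′; count)
open import Function using (_↔_; Inverse)
open import Level using () renaming (_⊔_ to _⊔ˡ_; suc to lsuc)
open import Relation.Binary using (Rel; IsDecTotalOrder)
open import Relation.Binary.PropositionalEquality using (_≡_; refl; sym)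
open import Relation.Nullary using (¬_; Dec; does; yes; no; contradiction)
open import Relation.Nullary.Decidable using (_×-dec_)
import Algebra.Definitions.RawMonoid as RawMonoidDefs
import Relation.Binary.Construct.NonStrictToStrict as ToStrict

record Graph (V : Set) : Set where
  field
    adj        : V → V → Bool
    adj-sym    : ∀ u v → adj u v ≡ adj v u
    adj-irrefl : ∀ v → adj v v ≡ false

open Graph public

infix 4 _≅_

_≅_ : {V W : Set} → Graph V → Graph W → Set
_≅_ {V} {W} G H =
  ∃ λ (f : V ↔ W) → ∀ u v → adj G u v ≡ adj H (Inverse.to f u) (Inverse.to f v)

data Walk {V : Set} (G : Graph V) : V → V → ℕ → Set where
  []  : ∀ {v} → Walk G v v 0
  _∷_ : ∀ {u v w k} → T (adj G u v) → Walk G v w k → Walk G u w (suc k)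

Connected : {V : Set} → Graph V → Set
Connected G = ∀ u v → ∃ λ k → Walk G u v k

Distance : {V : Set} → Graph V → V → V → ℕ → Set
Distance G u v k = Walk G u v k × (∀ l → Walk G u v l → k ℕ.≤ l)

HasDiameter : {V : Set} → Graph V → ℕ → Set
HasDiameter G d =
  (∀ u v k → Distance G u v k → k ℕ.≤ d) × ∃₂ λ u v → Distance G u v d

degree : ∀ {n} → Graph (Fin n) → Fin n → ℕ
degree G v = ∣ tabulate (adj G v) ∣

private
  ≡ᵇ-suc-irrefl : ∀ n → (suc n ≡ᵇ n) ≡ false
  ≡ᵇ-suc-irrefl zero    = refl
  ≡ᵇ-suc-irrefl (suc n) = ≡ᵇ-suc-irrefl n

consecutive : ℕ → ℕ → Bool
consecutive i j = (suc i ≡ᵇ j) ∨ (suc j ≡ᵇ i)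

distinct : ∀ {k} → Fin k → Fin k → Bool
distinct x y = not (does (x ≟ y))

-- The disjoint union of the path v₁ … vₚ and the complete graph on Fin k,
-- where inj₁ i stands for the path vertex with 1-based index suc (toℕ i),
-- together with an edge between the clique vertex x and vⱼ whenever
-- attach x j is true.
pathWithClique : ∀ p k → (Fin k → ℕ → Bool) → Graph (Fin p ⊎ Fin k)
pathWithClique p k attach = record { adj = e ; adj-sym = e-sym ; adj-irrefl = e-irrefl }
  where
  e : Fin p ⊎ Fin k → Fin p ⊎ Fin k → Bool
  e (inj₁ i) (inj₁ j) = consecutive (toℕ i) (toℕ j)
  e (inj₁ i) (inj₂ y) = attach y (suc (toℕ i))
  e (inj₂ x) (inj₁ j) = attach x (suc (toℕ j))
  e (inj₂ x) (inj₂ y) = distinct x y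

  e-sym : ∀ u v → e u v ≡ e v u
  e-sym (inj₁ i) (inj₁ j) = ∨-comm (suc (toℕ i) ≡ᵇ toℕ j) (suc (toℕ j) ≡ᵇ toℕ i)
  e-sym (inj₁ i) (inj₂ y) = refl
  e-sym (inj₂ x) (inj₁ j) = refl
  e-sym (inj₂ x) (inj₂ y) with x ≟ y | y ≟ x
  ... | yes _   | yes _   = refl
  ... | no _    | no _    = refl
  ... | yes x≡y | no y≢x  = contradiction (sym x≡y) y≢x
  ... | no x≢y  | yes y≡x = contradiction (sym y≡x) x≢y

  e-irrefl : ∀ v → e v v ≡ false
  e-irrefl (inj₁ i) rewrite ≡ᵇ-suc-irrefl (toℕ i) = refl
  e-irrefl (inj₂ x) with x ≟ x
  ... | yes _  = refl
  ... | no x≢x = contradiction refl x≢x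

-- j ∈ {t - 1 , t , t + 1}
near : ℕ → ℕ → Bool
near t j = (suc j ≡ᵇ t) ∨ (j ≡ᵇ t) ∨ (j ≡ᵇ suc t)

-- G_{n,d,t}, intended for 2 ≤ d ≤ n - 2 and 2 ≤ t ≤ d.
G-single : ∀ n d (t : ℕ) → Graph (Fin (suc d) ⊎ Fin (n ∸ suc d))
G-single n d t = pathWithClique (suc d) (n ∸ suc d) (λ _ → near t)

-- G_{n,d,r,a}, intended for 3 ≤ d ≤ n - 2, 2 ≤ r ≤ d - 1 and 1 ≤ a ≤ n - d - 2.
-- The a chosen clique vertices are the first a.
G-split : ∀ n d (r a : ℕ) → Graph (Fin (suc d) ⊎ Fin (n ∸ suc d))
G-split n d r a =
  pathWithClique (suc d) (n ∸ suc d)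
    (λ x → if toℕ x <ᵇ a then near r else near (suc r))

-- The reals are the intended instance; of their properties only those of an
-- ordered field with decidable order are kept (completeness is not used).
record OrderedField c ℓ₁ ℓ₂ : Set (lsuc (c ⊔ˡ ℓ₁ ⊔ˡ ℓ₂)) where
  infix 4 _≤_
  field
    commutativeRing : CommutativeRing c ℓ₁
  open CommutativeRing commutativeRing public hiding (sym; refl; trans; zero)
  field
    _≤_             : Rel Carrier ℓ₂
    isDecTotalOrder : IsDecTotalOrder _≈_ _≤_
    +-monoˡ-≤       : ∀ z {x y} → x ≤ y → x + z ≤ y + z
    *-nonNegative   : ∀ {x y} → 0# ≤ x → 0# ≤ y → 0# ≤ x * y
    0≉1             : ¬ (0# ≈ 1#)
    inverse         : ∀ x → ¬ (x ≈ 0#) → ∃ λ y → x * y ≈ 1#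

  open IsDecTotalOrder isDecTotalOrder public using (_≤?_) renaming (_≟_ to _≈?_)
  open ToStrict _≈_ _≤_ public using (_<_)

  _<?_ : ∀ x y → Dec (x < y)
  _<?_ = ToStrict.<-decidable _≈_ _≤_ _≈?_ _≤?_

  open RawMonoidDefs +-rawMonoid public using (sum) renaming (_×_ to _·_)

  fromℕ : ℕ → Carrier
  fromℕ k = k · 1#

module _ {c ℓ₁ ℓ₂} (𝔽 : OrderedField c ℓ₁ ℓ₂) where
  open OrderedField 𝔽

  Matrix : ℕ → Set c
  Matrix n = Fin n → Fin n → Carrier

  sign : ℕ → Carrier
  sign zero    = 1#
  sign (suc k) = - sign k

  -- Laplace expansion along the first row.
  det : ∀ {n} → Matrix n → Carrier
  det {zero}  M = 1#
  det {suc n} M =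
    sum λ j → sign (toℕ j) * M zero j * det (λ i k → M (suc i) (punchIn j k))

  diagonal : ∀ {n} → (Fin n → Carrier) → Matrix n
  diagonal d i j = if does (i ≟ j) then d i else 0#

  adjacencyMatrix degreeMatrix signlessLaplacian : ∀ {n} → Graph (Fin n) → Matrix n
  adjacencyMatrix G i j = if adj G i j then 1# else 0#
  degreeMatrix G = diagonal (λ i → fromℕ (degree G i))
  signlessLaplacian G i j = degreeMatrix G i j + adjacencyMatrix G i j

  -- det (x I - M)
  charPoly : ∀ {n} → Matrix n → Carrier → Carrier
  charPoly M x = det (λ i j → diagonal (λ _ → x) i j - M i j)

  -- The eigenvalues of M, listed with multiplicity as the roots of its
  -- characteristic polynomial.  An ordered field is infinite, so equality of
  -- all values is equality of polynomials.
  IsSpectrum : ∀ {n} → Matrix n → Vec Carrier n → Set (c ⊔ˡ ℓ₁)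
  IsSpectrum M μs = ∀ x → charPoly M x ≈ foldr′ _*_ 1# (map (λ μ → x - μ) μs)

  countIn : ∀ {n} → Carrier → Carrier → Vec Carrier n → ℕ
  countIn lo hi μs = count (λ μ → (lo ≤? μ) ×-dec (μ <? hi)) μs

  record Spectrum {n} (G : Graph (Fin n)) : Set (c ⊔ˡ ℓ₁) where
    field
      eigenvalues : Vec Carrier n
      isSpectrum  : IsSpectrum (signlessLaplacian G) eigenvalues

  -- m_G [ lo , hi )
  m : ∀ {n} {G : Graph (Fin n)} → Spectrum G → Carrier → Carrier → ℕ
  m S lo hi = countIn lo hi (Spectrum.eigenvalues S)

-- Q is symmetric and its characteristic polynomial splits, so Wielandt deflation, one root at
-- a time, gives an orthogonal family of eigenvectors that realises all roots with multiplicity.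
-- Counting roots below t = n - 3 thus becomes a question on the form of Q - t.
-- Lower bound: on a geodesic u - x - y - v the degrees of u and v add up to at most n - 2, so
-- by symmetry deg v ≤ n - 5; then the form is negative definite on the plane spanned by
-- e_u - e_x and e_v - e_x.
-- Equality: the complement of an extremal graph is a double star, with centres v₁ and v₄, and
-- on the vectors vanishing at the centres the form is bounded below by (∑ xᵢ)².
module Submission where

open import Defs
open import Algebra.Bundles using (CommutativeRing)
open import Algebra.Solver.Ring.AlmostCommutativeRing using (_-Raw-AlmostCommutative⟶_; fromCommutativeRing)
open import Data.Bool using (Bool; true; false; T; if_then_else_)
open import Data.Fin using (Fin; zero; suc; toℕ; punchIn)
open import Data.Fin.Properties using (_≟_; any?; suc-injective)
open import Data.Fin.Subset using (∣_∣)
open import Data.Integer as ℤ using (ℤ; +_; -[1+_]; _⊖_)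
open import Data.Maybe using (Maybe; just; nothing)
open import Data.Nat as ℕ using (ℕ; zero; suc; z≤n; s≤s; _∸_; _<ᵇ_)
open import Data.Nat.Tactic.RingSolver using (solve-∀)
open import Data.Product using (_×_; ∃; ∃₂; _,_; proj₁; proj₂)
open import Data.Sum using (_⊎_; inj₁; inj₂)
open import Data.Unit using (tt)
open import Data.Vec using (Vec; []; _∷_; count; foldr′; insertAt; lookup; map; replicate; tabulate)
open import Function using (_∘_; Inverse)
open import Function.Definitions using (Injective)
open import Level using (_⊔_)
open import Relation.Binary using (IsDecTotalOrder)
open import Relation.Binary.PropositionalEquality as ≡ using (_≡_; _≢_)
open import Relation.Nullary using (¬_; ¬?; does; yes; no; contradiction; decidable-stable)
open import Relation.Nullary.Decidable using (_×-dec_)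
open import Relation.Unary using (Pred; Decidable)
import Algebra.Properties.Ring as RingProperties
import Algebra.Properties.Semiring.Mult as SemiringMult
import Algebra.Properties.Semiring.Mult.TCOptimised as OptimisedMult
import Algebra.Properties.Semiring.Sum as SemiringSum
import Algebra.Solver.Ring as RingSolver
import Data.Integer.Properties as ℤₚ
import Data.Nat.Properties as ℕₚ
import Relation.Binary.Construct.NonStrictToStrict as ToStrict
import Relation.Binary.Reasoning.Setoid as SetoidReasoning

-- An ordered field offers no square roots and no limits, so eigenvectors stay unnormalised and
-- every eigenvalue has to be taken from the given list. Multiplicity is the obstacle: a root
-- repeated in the list makes the determinant vanish, but that yields a single eigenvector.
-- Deflation keeps the same n coordinates, where passing to an orthogonal complement would need a
-- change of basis; its price is a formula for the characteristic polynomial of M + σ v vᵀ. This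
-- formula and the kernel of a singular matrix both come from reading the determinant as the top
-- coefficient of the wedge product of the rows. The bound n - 5: at α e_u + β e_v + γ e_x with α +
-- β + γ = 0, the edge ux contributes 2αγ = β² - α² - γ². This helps the coefficients of α² and γ²
-- and harms that of β², which becomes deg v + 1 - t; it is at most -1 exactly when deg v ≤ n - 5.
-- If both ends had degree at least n - 4, the degree sum would give 2n - 8 ≤ n - 2, hence n ≤ 6.

-- A ring solver with integer coefficients.

-- With integer coefficients the solver can cancel x - x, which it cannot do
-- with coefficients in an abstract ring.
module IntegerCoefficients {c ℓ} (R : CommutativeRing c ℓ) where
  open CommutativeRing R hiding (zero)
  open RingProperties ring
  open OptimisedMult semiring using (1+×; ×-homo-+; ×1-homo-*) renaming (_×_ to _·_)
  open SetoidReasoning setoid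

  ⟦_⟧ℤ : ℤ → Carrier
  ⟦ + k ⟧ℤ      = k · 1#
  ⟦ -[1+ k ] ⟧ℤ = - (suc k · 1#)

  ⟦⟧-neg : ∀ i → ⟦ ℤ.- i ⟧ℤ ≈ - ⟦ i ⟧ℤ
  ⟦⟧-neg (+ zero)  = sym -0#≈0#
  ⟦⟧-neg (+ suc k) = refl
  ⟦⟧-neg -[1+ k ]  = sym (-‿involutive _)

  +-cancelˡ-minus : ∀ x y z → (x + y) - (x + z) ≈ y - z
  +-cancelˡ-minus x y z = begin
    (x + y) - (x + z)       ≈⟨ +-cong (+-comm x y) (sym (-‿+-comm x z)) ⟩
    (y + x) + (- x + - z)   ≈⟨ +-assoc y x _ ⟩
    y + (x + (- x + - z))   ≈⟨ +-congˡ (+-assoc x (- x) _) ⟨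
    y + (x + - x + - z)     ≈⟨ +-congˡ (+-congʳ (-‿inverseʳ x)) ⟩
    y + (0# + - z)          ≈⟨ +-congˡ (+-identityˡ _) ⟩
    y - z                   ∎

  ⟦⟧-⊖ : ∀ i j → ⟦ i ⊖ j ⟧ℤ ≈ i · 1# - j · 1#
  ⟦⟧-⊖ zero    zero    = sym (-‿inverseʳ 0#)
  ⟦⟧-⊖ zero    (suc j) = sym (+-identityˡ _)
  ⟦⟧-⊖ (suc i) zero    = sym (trans (+-congˡ -0#≈0#) (+-identityʳ _))
  ⟦⟧-⊖ (suc i) (suc j) = begin
    ⟦ suc i ⊖ suc j ⟧ℤ                ≡⟨ ≡.cong ⟦_⟧ℤ (ℤₚ.[1+m]⊖[1+n]≡m⊖n i j) ⟩
    ⟦ i ⊖ j ⟧ℤ                        ≈⟨ ⟦⟧-⊖ i j ⟩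
    i · 1# - j · 1#                   ≈⟨ +-cancelˡ-minus 1# _ _ ⟨
    (1# + i · 1#) - (1# + j · 1#)     ≈⟨ +-cong (1+× i 1#) (-‿cong (1+× j 1#)) ⟨
    suc i · 1# - suc j · 1#           ∎

  ⟦⟧-+ : ∀ i j → ⟦ i ℤ.+ j ⟧ℤ ≈ ⟦ i ⟧ℤ + ⟦ j ⟧ℤ
  ⟦⟧-+ (+ i)      (+ j)      = ×-homo-+ 1# i j
  ⟦⟧-+ (+ i)      (-[1+ j ]) = ⟦⟧-⊖ i (suc j)
  ⟦⟧-+ (-[1+ i ]) (+ j)      = trans (⟦⟧-⊖ j (suc i)) (+-comm _ _)
  ⟦⟧-+ (-[1+ i ]) (-[1+ j ]) = begin
    - (suc (suc (i ℕ.+ j)) · 1#)        ≡⟨ ≡.cong (λ k → - (suc k · 1#)) (ℕₚ.+-suc i j) ⟨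
    - ((suc i ℕ.+ suc j) · 1#)          ≈⟨ -‿cong (×-homo-+ 1# (suc i) (suc j)) ⟩
    - (suc i · 1# + suc j · 1#)         ≈⟨ -‿+-comm _ _ ⟨
    - (suc i · 1#) + - (suc j · 1#)     ∎

  ⟦⟧-*-pos : ∀ i j → ⟦ + i ℤ.* j ⟧ℤ ≈ ⟦ + i ⟧ℤ * ⟦ j ⟧ℤ
  ⟦⟧-*-pos i (+ j) = begin
    ⟦ + i ℤ.* + j ⟧ℤ     ≡⟨ ≡.cong ⟦_⟧ℤ (ℤₚ.pos-* i j) ⟨
    (i ℕ.* j) · 1#       ≈⟨ ×1-homo-* i j ⟩
    (i · 1#) * (j · 1#)  ∎
  ⟦⟧-*-pos i -[1+ j ] = begin
    ⟦ + i ℤ.* -[1+ j ] ⟧ℤ         ≡⟨ ≡.cong ⟦_⟧ℤ (ℤₚ.neg-distribʳ-* (+ i) (+ suc j)) ⟨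
    ⟦ ℤ.- (+ i ℤ.* + suc j) ⟧ℤ    ≈⟨ ⟦⟧-neg (+ i ℤ.* + suc j) ⟩
    - ⟦ + i ℤ.* + suc j ⟧ℤ        ≈⟨ -‿cong (⟦⟧-*-pos i (+ suc j)) ⟩
    - (⟦ + i ⟧ℤ * ⟦ + suc j ⟧ℤ)   ≈⟨ -‿distribʳ-* _ _ ⟩
    ⟦ + i ⟧ℤ * ⟦ -[1+ j ] ⟧ℤ      ∎
  ⟦⟧-* : ∀ i j → ⟦ i ℤ.* j ⟧ℤ ≈ ⟦ i ⟧ℤ * ⟦ j ⟧ℤ
  ⟦⟧-* (+ i)    j = ⟦⟧-*-pos i j
  ⟦⟧-* -[1+ i ] j = begin
    ⟦ -[1+ i ] ℤ.* j ⟧ℤ         ≡⟨ ≡.cong ⟦_⟧ℤ (ℤₚ.neg-distribˡ-* (+ suc i) j) ⟨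
    ⟦ ℤ.- (+ suc i ℤ.* j) ⟧ℤ    ≈⟨ ⟦⟧-neg (+ suc i ℤ.* j) ⟩
    - ⟦ + suc i ℤ.* j ⟧ℤ        ≈⟨ -‿cong (⟦⟧-*-pos (suc i) j) ⟩
    - (⟦ + suc i ⟧ℤ * ⟦ j ⟧ℤ)   ≈⟨ -‿distribˡ-* _ _ ⟩
    ⟦ -[1+ i ] ⟧ℤ * ⟦ j ⟧ℤ      ∎

  ℤ⟶R : ℤ.+-*-rawRing -Raw-AlmostCommutative⟶ fromCommutativeRing R
  ℤ⟶R = record
    { ⟦_⟧ = ⟦_⟧ℤ ; +-homo = ⟦⟧-+ ; *-homo = ⟦⟧-* ; -‿homo = ⟦⟧-neg ; 0-homo = refl ; 1-homo = refl }

  coefficient≟ : ∀ i j → Maybe (⟦ i ⟧ℤ ≈ ⟦ j ⟧ℤ)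
  coefficient≟ i j with i ℤ.≟ j
  ... | yes ≡.refl = just refl
  ... | no _       = nothing

  open RingSolver ℤ.+-*-rawRing (fromCommutativeRing R) ℤ⟶R coefficient≟ public
    using (solve; _:=_; _:+_; _:*_; _:-_; :-_; con)

-- Ordered fields, finite sums and the dot product.

module OrderedFieldProperties {c ℓ₁ ℓ₂} (𝔽 : OrderedField c ℓ₁ ℓ₂) where
  open OrderedField 𝔽 public
  open IsDecTotalOrder isDecTotalOrder public using (antisym; total; ≤-respˡ-≈; ≤-respʳ-≈)
    renaming (refl to ≤-refl; trans to ≤-trans; reflexive to ≤-reflexive)
  module ≈ = IsDecTotalOrder.Eq isDecTotalOrder
  open SetoidReasoning setoid public
  open IntegerCoefficients commutativeRing public
    using (solve; _:=_; _:+_; _:*_; _:-_; :-_; con)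
  open RingProperties ring public using (-0#≈0#)
  open SemiringSum semiring public
    using (sum-cong-≋; sum-replicate; sum-replicate-zero; ∑-distrib-+; ∑-comm; *-distribˡ-sum; *-distribʳ-sum)

  cancel-nonzero : ∀ {x y} → ¬ x ≈ 0# → x * y ≈ 0# → y ≈ 0#
  cancel-nonzero {x} {y} x≉0 xy≈0 with inverse x x≉0
  ... | x⁻¹ , xx⁻¹≈1 = begin
    y              ≈⟨ *-identityˡ y ⟨
    1# * y         ≈⟨ *-congʳ xx⁻¹≈1 ⟨
    x * x⁻¹ * y    ≈⟨ solve 3 (λ x z y → x :* z :* y := z :* (x :* y)) ≈.refl x x⁻¹ y ⟩
    x⁻¹ * (x * y)  ≈⟨ *-congˡ xy≈0 ⟩
    x⁻¹ * 0#       ≈⟨ zeroʳ x⁻¹ ⟩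
    0#             ∎

  x-y≈0⇒x≈y : ∀ {x y} → x - y ≈ 0# → x ≈ y
  x-y≈0⇒x≈y {x} {y} x-y≈0 = begin
    x            ≈⟨ solve 2 (λ x y → x := (x :- y) :+ y) ≈.refl x y ⟩
    (x - y) + y  ≈⟨ +-congʳ x-y≈0 ⟩
    0# + y       ≈⟨ +-identityˡ y ⟩
    y            ∎

  x≈y⇒x-y≈0 : ∀ {x y} → x ≈ y → x - y ≈ 0#
  x≈y⇒x-y≈0 {x} {y} x≈y = ≈.trans (+-congʳ x≈y) (-‿inverseʳ y)

  +-mono-≤ : ∀ {w x y z} → w ≤ x → y ≤ z → w + y ≤ x + z
  +-mono-≤ {w} {x} {y} {z} w≤x y≤z = ≤-trans (+-monoˡ-≤ y w≤x)
    (≤-respˡ-≈ (+-comm y x) (≤-respʳ-≈ (+-comm z x) (+-monoˡ-≤ x y≤z)))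

  x≤y⇒0≤y-x : ∀ {x y} → x ≤ y → 0# ≤ y - x
  x≤y⇒0≤y-x {x} x≤y = ≤-respˡ-≈ (-‿inverseʳ x) (+-monoˡ-≤ (- x) x≤y)

  0≤y-x⇒x≤y : ∀ {x y} → 0# ≤ y - x → x ≤ y
  0≤y-x⇒x≤y {x} {y} p = ≤-respˡ-≈ (+-identityˡ x)
    (≤-respʳ-≈ (solve 2 (λ y x → (y :- x) :+ x := y) ≈.refl y x) (+-monoˡ-≤ x p))

  +-nonNegative : ∀ {x y} → 0# ≤ x → 0# ≤ y → 0# ≤ x + y
  +-nonNegative p q = ≤-respˡ-≈ (+-identityˡ 0#) (+-mono-≤ p q)

  x≤0⇒0≤-x : ∀ {x} → x ≤ 0# → 0# ≤ - x
  x≤0⇒0≤-x {x} x≤0 = ≤-respʳ-≈ (+-identityˡ (- x)) (x≤y⇒0≤y-x x≤0)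

  *-monoˡ-≤ : ∀ {x y} z → 0# ≤ z → x ≤ y → z * x ≤ z * y
  *-monoˡ-≤ {x} {y} z 0≤z x≤y = 0≤y-x⇒x≤y
    (≤-respʳ-≈ (solve 3 (λ x y z → z :* (y :- x) := z :* y :- z :* x) ≈.refl x y z)
      (*-nonNegative 0≤z (x≤y⇒0≤y-x x≤y)))

  square-nonNegative : ∀ x → 0# ≤ x * x
  square-nonNegative x with total 0# x
  ... | inj₁ 0≤x = *-nonNegative 0≤x 0≤x
  ... | inj₂ x≤0 = ≤-respʳ-≈ (solve 1 (λ x → :- x :* :- x := x :* x) ≈.refl x)
                     (*-nonNegative (x≤0⇒0≤-x x≤0) (x≤0⇒0≤-x x≤0))

  0≤1 : 0# ≤ 1#
  0≤1 = ≤-respʳ-≈ (*-identityˡ 1#) (square-nonNegative 1#)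

  nonNegative-sum≈0ˡ : ∀ {x y} → 0# ≤ x → 0# ≤ y → x + y ≤ 0# → x ≈ 0#
  nonNegative-sum≈0ˡ {x} {y} 0≤x 0≤y x+y≤0 = antisym
    (≤-trans (≤-respˡ-≈ (+-identityʳ x) (+-mono-≤ (≤-refl {x}) 0≤y)) x+y≤0) 0≤x

  nonNegative-sum≈0ʳ : ∀ {x y} → 0# ≤ x → 0# ≤ y → x + y ≤ 0# → y ≈ 0#
  nonNegative-sum≈0ʳ 0≤x 0≤y x+y≤0 = nonNegative-sum≈0ˡ 0≤y 0≤x (≤-respˡ-≈ (+-comm _ _) x+y≤0)

  square≈0 : ∀ {x} → x * x ≈ 0# → x ≈ 0#
  square≈0 {x} xx≈0 with x ≈? 0#
  ... | yes x≈0 = x≈0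
  ... | no  x≉0 = cancel-nonzero x≉0 xx≈0

  ≮⇒≥ : ∀ {x y} → ¬ x < y → y ≤ x
  ≮⇒≥ = ToStrict.≮⇒≥ _≈_ _≤_ ≈.sym _≈?_ ≤-reflexive total

  sum-zero : ∀ {k} {f : Fin k → Carrier} → (∀ i → f i ≈ 0#) → sum f ≈ 0#
  sum-zero {k} f≈0 = ≈.trans (sum-cong-≋ f≈0) (sum-replicate-zero k)

  sum-single : ∀ {k} (f : Fin k → Carrier) i → (∀ j → j ≢ i → f j ≈ 0#) → sum f ≈ f i
  sum-single f zero    rest = ≈.trans (+-congˡ (sum-zero (λ j → rest (suc j) λ ()))) (+-identityʳ _)
  sum-single f (suc i) rest = ≈.trans
    (+-cong (rest zero λ ()) (sum-single (f ∘ suc) i λ j j≢i → rest (suc j) λ { ≡.refl → j≢i ≡.refl }))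
    (+-identityˡ _)

  sum-mono-≤ : ∀ {k} {f g : Fin k → Carrier} → (∀ i → f i ≤ g i) → sum f ≤ sum g
  sum-mono-≤ {zero}  f≤g = ≤-refl
  sum-mono-≤ {suc k} f≤g = +-mono-≤ (f≤g zero) (sum-mono-≤ (f≤g ∘ suc))

  sum-nonNegative : ∀ {k} {f : Fin k → Carrier} → (∀ i → 0# ≤ f i) → 0# ≤ sum f
  sum-nonNegative {k} 0≤f = ≤-respˡ-≈ (sum-replicate-zero k) (sum-mono-≤ 0≤f)

  nonNegative-sum≈0 : ∀ {k} {f : Fin k → Carrier} → (∀ i → 0# ≤ f i) → sum f ≤ 0# → ∀ i → f i ≈ 0#
  nonNegative-sum≈0 0≤f ∑≤0 zero    = nonNegative-sum≈0ˡ (0≤f zero) (sum-nonNegative (0≤f ∘ suc)) ∑≤0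
  nonNegative-sum≈0 0≤f ∑≤0 (suc i) = nonNegative-sum≈0 (0≤f ∘ suc)
    (≤-reflexive (nonNegative-sum≈0ʳ (0≤f zero) (sum-nonNegative (0≤f ∘ suc)) ∑≤0)) i

  infix 8 _∙_
  _∙_ : ∀ {k} → (Fin k → Carrier) → (Fin k → Carrier) → Carrier
  x ∙ y = sum λ i → x i * y i

  NonZero : ∀ {k} → (Fin k → Carrier) → Set ℓ₁
  NonZero x = ∃ λ i → ¬ x i ≈ 0#

  ∙-cong : ∀ {k} {w x y z : Fin k → Carrier} → (∀ i → w i ≈ x i) → (∀ i → y i ≈ z i) → w ∙ y ≈ x ∙ z
  ∙-cong w≈x y≈z = sum-cong-≋ λ i → *-cong (w≈x i) (y≈z i)

  ∙-comm : ∀ {k} (x y : Fin k → Carrier) → x ∙ y ≈ y ∙ x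
  ∙-comm x y = sum-cong-≋ λ i → *-comm (x i) (y i)

  ∙-+ʳ : ∀ {k} (x y z : Fin k → Carrier) → x ∙ (λ i → y i + z i) ≈ x ∙ y + x ∙ z
  ∙-+ʳ x y z = ≈.trans (sum-cong-≋ λ i → distribˡ (x i) (y i) (z i)) (∑-distrib-+ (λ i → x i * y i) (λ i → x i * z i))

  ∙-*ʳ : ∀ {k} a (x y : Fin k → Carrier) → x ∙ (λ i → a * y i) ≈ a * x ∙ y
  ∙-*ʳ a x y = ≈.trans
    (sum-cong-≋ λ i → solve 3 (λ a x y → x :* (a :* y) := a :* (x :* y)) ≈.refl a (x i) (y i))
    (≈.sym (*-distribˡ-sum a (λ i → x i * y i)))

  ∙-+*ˡ : ∀ {k} (x : Fin k → Carrier) a y z → (λ i → x i + a * y i) ∙ z ≈ x ∙ z + a * y ∙ z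
  ∙-+*ˡ x a y z = begin
    (λ i → x i + a * y i) ∙ z          ≈⟨ ∙-comm (λ i → x i + a * y i) z ⟩
    z ∙ (λ i → x i + a * y i)          ≈⟨ ∙-+ʳ z x (λ i → a * y i) ⟩
    z ∙ x + z ∙ (λ i → a * y i)        ≈⟨ +-cong (∙-comm z x) (∙-*ʳ a z y) ⟩
    x ∙ z + a * z ∙ y                  ≈⟨ +-congˡ (*-congˡ (∙-comm z y)) ⟩
    x ∙ z + a * y ∙ z                  ∎

  ∙-sumʳ : ∀ {k l} (x : Fin k → Carrier) (a : Fin l → Carrier) (v : Fin l → Fin k → Carrier) →
    x ∙ (λ i → sum λ j → a j * v j i) ≈ sum λ j → a j * x ∙ v j
  ∙-sumʳ x a v = begin
    (sum λ i → x i * sum λ j → a j * v j i)       ≈⟨ sum-cong-≋ (λ i → *-distribˡ-sum (x i) (λ j → a j * v j i)) ⟩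
    (sum λ i → sum λ j → x i * (a j * v j i))     ≈⟨ ∑-comm (λ i j → x i * (a j * v j i)) ⟩
    (sum λ j → sum λ i → x i * (a j * v j i))     ≈⟨ sum-cong-≋ (λ j → ∙-*ʳ (a j) x (v j)) ⟩
    (sum λ j → a j * x ∙ v j)                     ∎

  ∙-positive : ∀ {k} (x : Fin k → Carrier) → 0# ≤ x ∙ x
  ∙-positive x = sum-nonNegative λ i → square-nonNegative (x i)

  -- A sum of squares in an ordered field vanishes only termwise. This is what permits division by
  -- `v ∙ v` where a norm would require a square root.
  ∙-definite : ∀ {k} {x : Fin k → Carrier} → x ∙ x ≤ 0# → ∀ i → x i ≈ 0#
  ∙-definite {x = x} p i = square≈0 (nonNegative-sum≈0 (λ j → square-nonNegative (x j)) p i)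

  nonZero⇒∙≉0 : ∀ {k} {x : Fin k → Carrier} → NonZero x → ¬ x ∙ x ≈ 0#
  nonZero⇒∙≉0 (i , xᵢ≉0) p = xᵢ≉0 (∙-definite (≤-reflexive p) i)

  δ : ∀ {k} → Fin k → Fin k → Carrier
  δ i j = if does (i ≟ j) then 1# else 0#

  δ-diagonal : ∀ {k} (i : Fin k) → δ i i ≈ 1#
  δ-diagonal i with i ≟ i
  ... | yes _  = ≈.refl
  ... | no i≢i = contradiction ≡.refl i≢i

  δ-offDiagonal : ∀ {k} {i j : Fin k} → i ≢ j → δ i j ≈ 0#
  δ-offDiagonal {i = i} {j} i≢j with i ≟ j
  ... | yes i≡j = contradiction i≡j i≢j
  ... | no _    = ≈.refl

  δ-∙ : ∀ {k} (i : Fin k) x → δ i ∙ x ≈ x i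
  δ-∙ i x = ≈.trans
    (sum-single _ i λ j j≢i → ≈.trans (*-congʳ (δ-offDiagonal (j≢i ∘ ≡.sym))) (zeroˡ _))
    (≈.trans (*-congʳ (δ-diagonal i)) (*-identityˡ _))

  sum-δ : ∀ {k} (i : Fin k) → sum (δ i) ≈ 1#
  sum-δ i = ≈.trans (sum-single (δ i) i λ j j≢i → δ-offDiagonal (j≢i ∘ ≡.sym)) (δ-diagonal i)

  fromℕ-+ : ∀ k l → fromℕ (k ℕ.+ l) ≈ fromℕ k + fromℕ l
  fromℕ-+ = SemiringMult.×-homo-+ semiring 1#

  fromℕ-nonNegative : ∀ k → 0# ≤ fromℕ k
  fromℕ-nonNegative zero    = ≤-refl
  fromℕ-nonNegative (suc k) = +-nonNegative 0≤1 (fromℕ-nonNegative k)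

  fromℕ-mono-≤ : ∀ {k l} → k ℕ.≤ l → fromℕ k ≤ fromℕ l
  fromℕ-mono-≤ {l = l}     z≤n       = fromℕ-nonNegative l
  fromℕ-mono-≤ {suc k} {suc l} (s≤s k≤l) = +-mono-≤ ≤-refl (fromℕ-mono-≤ {k} {l} k≤l)

  -- Cancelling `fromℕ k` would leave 1 ≤ 0. This is characteristic zero; it later keeps the sample
  -- points of a polynomial apart.
  fromℕ-suc≰ : ∀ k → ¬ fromℕ (suc k) ≤ fromℕ k
  fromℕ-suc≰ k p = 0≉1 (antisym 0≤1
    (≤-respˡ-≈ (solve 1 (λ x → (con (+ 1) :+ x) :- x := con (+ 1)) ≈.refl (fromℕ k))
      (≤-respʳ-≈ (-‿inverseʳ (fromℕ k)) (+-monoˡ-≤ (- fromℕ k) p))))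

  -- Degrees are counted below as sums of 0/1 entries in the field; this carries the resulting
  -- inequalities back to `ℕ`.
  fromℕ-cancel-≤ : ∀ {k l} → fromℕ k ≤ fromℕ l → k ℕ.≤ l
  fromℕ-cancel-≤ {k} {l} p with k ℕ.≤? l
  ... | yes k≤l = k≤l
  ... | no  k≰l = contradiction (≤-trans (fromℕ-mono-≤ {suc l} {k} (ℕₚ.≰⇒> k≰l)) p) (fromℕ-suc≰ l)

-- Determinants through the exterior algebra.

-- An element of the exterior algebra on e₀ … eₖ₋₁ is given by its coefficients
-- with respect to the monomials, a monomial being an indicator vector.
module ExteriorAlgebra {c ℓ₁ ℓ₂} (𝔽 : OrderedField c ℓ₁ ℓ₂) where
  open OrderedFieldProperties 𝔽

  Form : ℕ → Set c
  Form k = Vec Bool k → Carrier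

  infix 4 _≋_
  _≋_ : ∀ {k} → Form k → Form k → Set ℓ₁
  φ ≋ ψ = ∀ S → φ S ≈ ψ S

  one : ∀ {k} → Form k
  one []          = 1#
  one (false ∷ S) = one S
  one (true  ∷ S) = 0#

  -- r₀ e₀ ∧ (φ₀ + e₀ ∧ φ₁) = e₀ ∧ r₀ φ₀, while the rest of r anticommutes with e₀.
  wedge : ∀ {k} → (Fin k → Carrier) → Form k → Form k
  wedge r φ []          = 0#
  wedge r φ (false ∷ S) = wedge (r ∘ suc) (φ ∘ (false ∷_)) S
  wedge r φ (true  ∷ S) = r zero * φ (false ∷ S) - wedge (r ∘ suc) (φ ∘ (true ∷_)) S

  wedge-cong : ∀ {k} {r s : Fin k → Carrier} {φ ψ} → (∀ i → r i ≈ s i) → φ ≋ ψ → wedge r φ ≋ wedge s ψ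
  wedge-cong r≈s φ≋ψ []          = ≈.refl
  wedge-cong r≈s φ≋ψ (false ∷ S) = wedge-cong (r≈s ∘ suc) (φ≋ψ ∘ (false ∷_)) S
  wedge-cong r≈s φ≋ψ (true  ∷ S) = +-cong (*-cong (r≈s zero) (φ≋ψ (false ∷ S)))
    (-‿cong (wedge-cong (r≈s ∘ suc) (φ≋ψ ∘ (true ∷_)) S))

  wedge-linearʳ : ∀ {k} (r : Fin k → Carrier) a b φ ψ →
    wedge r (λ S → a * φ S + b * ψ S) ≋ λ S → a * wedge r φ S + b * wedge r ψ S
  wedge-linearʳ r a b φ ψ []          = solve 2 (λ a b → con (+ 0) := a :* con (+ 0) :+ b :* con (+ 0)) ≈.refl a b
  wedge-linearʳ r a b φ ψ (false ∷ S) = wedge-linearʳ (r ∘ suc) a b (φ ∘ (false ∷_)) (ψ ∘ (false ∷_)) S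
  wedge-linearʳ r a b φ ψ (true  ∷ S) = ≈.trans
    (+-congˡ (-‿cong (wedge-linearʳ (r ∘ suc) a b (φ ∘ (true ∷_)) (ψ ∘ (true ∷_)) S)))
    (solve 7 (λ x a b φ ψ u v → x :* (a :* φ :+ b :* ψ) :- (a :* u :+ b :* v) :=
        a :* (x :* φ :- u) :+ b :* (x :* ψ :- v)) ≈.refl
      (r zero) a b (φ (false ∷ S)) (ψ (false ∷ S)) _ _)

  wedge-linearˡ : ∀ {k} a b (r s : Fin k → Carrier) φ →
    wedge (λ i → a * r i + b * s i) φ ≋ λ S → a * wedge r φ S + b * wedge s φ S
  wedge-linearˡ a b r s φ []          = solve 2 (λ a b → con (+ 0) := a :* con (+ 0) :+ b :* con (+ 0)) ≈.refl a b
  wedge-linearˡ a b r s φ (false ∷ S) = wedge-linearˡ a b (r ∘ suc) (s ∘ suc) (φ ∘ (false ∷_)) S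
  wedge-linearˡ a b r s φ (true  ∷ S) = ≈.trans
    (+-congˡ (-‿cong (wedge-linearˡ a b (r ∘ suc) (s ∘ suc) (φ ∘ (true ∷_)) S)))
    (solve 7 (λ x y a b φ u v → (a :* x :+ b :* y) :* φ :- (a :* u :+ b :* v) :=
        a :* (x :* φ :- u) :+ b :* (y :* φ :- v)) ≈.refl
      (r zero) (s zero) a b (φ (false ∷ S)) _ _)

  wedge-+ʳ : ∀ {k} (r : Fin k → Carrier) φ ψ → wedge r (λ S → φ S + ψ S) ≋ λ S → wedge r φ S + wedge r ψ S
  wedge-+ʳ r φ ψ S = ≈.trans
    (wedge-cong (λ _ → ≈.refl) (λ T → ≈.sym (+-cong (*-identityˡ (φ T)) (*-identityˡ (ψ T)))) S)
    (≈.trans (wedge-linearʳ r 1# 1# φ ψ S) (+-cong (*-identityˡ _) (*-identityˡ _)))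

  wedge-*ʳ : ∀ {k} (r : Fin k → Carrier) a φ → wedge r (λ S → a * φ S) ≋ λ S → a * wedge r φ S
  wedge-*ʳ r a φ S = ≈.trans
    (wedge-cong (λ _ → ≈.refl) (λ T → solve 2 (λ a x → a :* x := a :* x :+ con (+ 0) :* x) ≈.refl a (φ T)) S)
    (≈.trans (wedge-linearʳ r a 0# φ φ S) (solve 2 (λ a x → a :* x :+ con (+ 0) :* x := a :* x) ≈.refl a _))

  wedge-zeroˡ : ∀ {k} (φ : Form k) S → wedge (λ _ → 0#) φ S ≈ 0#
  wedge-zeroˡ φ []          = ≈.refl
  wedge-zeroˡ φ (false ∷ S) = wedge-zeroˡ (φ ∘ (false ∷_)) S
  wedge-zeroˡ φ (true  ∷ S) = begin
    0# * φ (false ∷ S) - wedge (λ _ → 0#) (φ ∘ (true ∷_)) S   ≈⟨ +-cong (zeroˡ _) (-‿cong (wedge-zeroˡ (φ ∘ (true ∷_)) S)) ⟩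
    0# - 0#                                                   ≈⟨ -‿inverseʳ 0# ⟩
    0#                                                        ∎

  wedge-zeroʳ : ∀ {k} (r : Fin k → Carrier) {φ} → (∀ S → φ S ≈ 0#) → ∀ S → wedge r φ S ≈ 0#
  wedge-zeroʳ r {φ} φ≈0 S = ≈.trans
    (wedge-cong (λ _ → ≈.refl) (λ T → ≈.trans (φ≈0 T) (≈.sym (zeroˡ (φ T)))) S)
    (≈.trans (wedge-*ʳ r 0# φ S) (zeroˡ _))

  wedge-+* : ∀ {k} (r s : Fin k → Carrier) b φ →
    wedge (λ i → r i + b * s i) φ ≋ λ S → wedge r φ S + b * wedge s φ S
  wedge-+* r s b φ S = ≈.trans
    (wedge-cong (λ i → +-congʳ (≈.sym (*-identityˡ (r i)))) (λ _ → ≈.refl) S)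
    (≈.trans (wedge-linearˡ 1# b r s φ S) (+-congʳ (*-identityˡ _)))

  wedge-*-ʳ : ∀ {k} (r : Fin k → Carrier) a φ ψ →
    wedge r (λ S → a * φ S - ψ S) ≋ λ S → a * wedge r φ S - wedge r ψ S
  wedge-*-ʳ r a φ ψ S = ≈.trans
    (wedge-cong (λ _ → ≈.refl) (λ T → +-congˡ (solve 1 (λ x → :- x := con -[1+ 0 ] :* x) ≈.refl (ψ T))) S)
    (≈.trans (wedge-linearʳ r a (- 1#) φ ψ S) (+-congˡ (solve 1 (λ x → con -[1+ 0 ] :* x := :- x) ≈.refl _)))

  -- With r = r₀ e₀ + r′ and φ = φ₀ + e₀ ∧ φ₁, the two cross terms r₀ e₀ ∧ r′ ∧ φ₀ arise with
  -- opposite signs, and r′ ∧ r′ vanishes by induction.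
  wedge-alternating : ∀ {k} (r : Fin k → Carrier) φ S → wedge r (wedge r φ) S ≈ 0#
  wedge-alternating r φ []          = ≈.refl
  wedge-alternating r φ (false ∷ S) = wedge-alternating (r ∘ suc) (φ ∘ (false ∷_)) S
  wedge-alternating r φ (true  ∷ S) = begin
    x - wedge r′ (λ T → r zero * φ₀ T - wedge r′ φ₁ T) S   ≈⟨ +-congˡ (-‿cong (wedge-*-ʳ r′ (r zero) φ₀ (wedge r′ φ₁) S)) ⟩
    x - (x - wedge r′ (wedge r′ φ₁) S)                     ≈⟨ +-congˡ (-‿cong (+-congˡ (-‿cong (wedge-alternating r′ φ₁ S)))) ⟩
    x - (x - 0#)                                           ≈⟨ solve 1 (λ x → x :- (x :- con (+ 0)) := con (+ 0)) ≈.refl x ⟩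
    0#                                                     ∎
    where
    r′ = r ∘ suc
    φ₀ = φ ∘ (false ∷_)
    φ₁ = φ ∘ (true ∷_)
    x  = r zero * wedge r′ φ₀ S

  wedge-anticommutative : ∀ {k} (r s : Fin k → Carrier) φ S → wedge r (wedge s φ) S ≈ - wedge s (wedge r φ) S
  wedge-anticommutative r s φ []          = ≈.sym -0#≈0#
  wedge-anticommutative r s φ (false ∷ S) = wedge-anticommutative (r ∘ suc) (s ∘ suc) (φ ∘ (false ∷_)) S
  wedge-anticommutative r s φ (true  ∷ S) = begin
    x - wedge r′ (λ T → s zero * φ₀ T - wedge s′ φ₁ T) S     ≈⟨ +-congˡ (-‿cong (wedge-*-ʳ r′ (s zero) φ₀ (wedge s′ φ₁) S)) ⟩
    x - (y - wedge r′ (wedge s′ φ₁) S)                       ≈⟨ +-congˡ (-‿cong (+-congˡ (-‿cong (wedge-anticommutative r′ s′ φ₁ S)))) ⟩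
    x - (y - - wedge s′ (wedge r′ φ₁) S)                     ≈⟨ solve 3 (λ x y z → x :- (y :- (:- z)) := :- (y :- (x :- z))) ≈.refl x y _ ⟩
    - (y - (x - wedge s′ (wedge r′ φ₁) S))                   ≈⟨ -‿cong (+-congˡ (-‿cong (wedge-*-ʳ s′ (r zero) φ₀ (wedge r′ φ₁) S))) ⟨
    - (y - wedge s′ (λ T → r zero * φ₀ T - wedge r′ φ₁ T) S) ∎
    where
    r′ = r ∘ suc
    s′ = s ∘ suc
    φ₀ = φ ∘ (false ∷_)
    φ₁ = φ ∘ (true ∷_)
    x  = r zero * wedge s′ φ₀ S
    y  = s zero * wedge r′ φ₀ S

  Rows : ℕ → ℕ → Set c
  Rows l k = Fin l → Fin k → Carrier

  rowProduct : ∀ {l k} → Rows l k → Form k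
  rowProduct {zero}  M = one
  rowProduct {suc l} M = wedge (M zero) (rowProduct (M ∘ suc))

  rowProduct-cong : ∀ {l k} {M N : Rows l k} → (∀ i j → M i j ≈ N i j) → rowProduct M ≋ rowProduct N
  rowProduct-cong {zero}  M≈N S = ≈.refl
  rowProduct-cong {suc l} M≈N S = wedge-cong (M≈N zero) (rowProduct-cong (M≈N ∘ suc)) S

  -- Anticommutation moves the extra factor next to its copy inside the product.
  row∧rowProduct : ∀ {l k} (M : Rows l k) i S → wedge (M i) (rowProduct M) S ≈ 0#
  row∧rowProduct M zero    S = wedge-alternating (M zero) _ S
  row∧rowProduct M (suc i) S = begin
    wedge (M (suc i)) (wedge (M zero) (rowProduct (M ∘ suc))) S     ≈⟨ wedge-anticommutative (M (suc i)) (M zero) _ S ⟩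
    - wedge (M zero) (wedge (M (suc i)) (rowProduct (M ∘ suc))) S   ≈⟨ -‿cong (wedge-zeroʳ (M zero) (row∧rowProduct (M ∘ suc) i) S) ⟩
    - 0#                                                            ≈⟨ -0#≈0# ⟩
    0#                                                              ∎

  -- The part of degree one in ρ of the product of the rows M i + a i ρ; the
  -- parts of higher degree vanish.
  variation : ∀ {l k} → Rows l k → (Fin l → Carrier) → (Fin k → Carrier) → Form k
  variation {zero}  M a ρ S = 0#
  variation {suc l} M a ρ S =
    wedge (M zero) (variation (M ∘ suc) (a ∘ suc) ρ) S + a zero * wedge ρ (rowProduct (M ∘ suc)) S

  variation-cong : ∀ {l k} (M : Rows l k) a {ρ σ} → (∀ i → ρ i ≈ σ i) → variation M a ρ ≋ variation M a σ
  variation-cong {zero}  M a ρ≈σ S = ≈.refl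
  variation-cong {suc l} M a ρ≈σ S = +-cong
    (wedge-cong (λ _ → ≈.refl) (variation-cong (M ∘ suc) (a ∘ suc) ρ≈σ) S)
    (*-congˡ (wedge-cong ρ≈σ (λ _ → ≈.refl) S))

  -- Every summand of the variation already contains the factor ρ. This is also why the terms of
  -- higher degree in ρ vanish.
  ρ∧variation : ∀ {l k} (M : Rows l k) a ρ S → wedge ρ (variation M a ρ) S ≈ 0#
  ρ∧variation {zero}  M a ρ S = wedge-zeroʳ ρ (λ _ → ≈.refl) S
  ρ∧variation {suc l} M a ρ S = begin
    wedge ρ (λ T → wedge (M zero) φ T + a zero * wedge ρ ψ T) S            ≈⟨ wedge-+ʳ ρ _ _ S ⟩
    wedge ρ (wedge (M zero) φ) S + wedge ρ (λ T → a zero * wedge ρ ψ T) S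
      ≈⟨ +-cong (wedge-anticommutative ρ (M zero) φ S) (wedge-*ʳ ρ (a zero) _ S) ⟩
    - wedge (M zero) (wedge ρ φ) S + a zero * wedge ρ (wedge ρ ψ) S
      ≈⟨ +-cong (-‿cong (wedge-zeroʳ (M zero) (ρ∧variation (M ∘ suc) (a ∘ suc) ρ) S)) (*-congˡ (wedge-alternating ρ ψ S)) ⟩
    - 0# + a zero * 0#                                                     ≈⟨ solve 1 (λ a → :- con (+ 0) :+ a :* con (+ 0) := con (+ 0)) ≈.refl (a zero) ⟩
    0#                                                                     ∎
    where
    φ = variation (M ∘ suc) (a ∘ suc) ρ
    ψ = rowProduct (M ∘ suc)

  -- A rank-one update changes the product only to first order, since ρ ∧ ρ = 0. It serves twice:
  -- for clearing a column by a pivot row and for deflation.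
  rowProduct-update : ∀ {l k} (M : Rows l k) a ρ →
    rowProduct (λ i j → M i j + a i * ρ j) ≋ λ S → rowProduct M S + variation M a ρ S
  rowProduct-update {zero}  M a ρ S = ≈.sym (+-identityʳ _)
  rowProduct-update {suc l} M a ρ S = begin
    wedge (λ j → M zero j + a zero * ρ j) Ψ S             ≈⟨ wedge-+* (M zero) ρ (a zero) Ψ S ⟩
    wedge (M zero) Ψ S + a zero * wedge ρ Ψ S             ≈⟨ +-cong (split (M zero)) (*-congˡ (split ρ)) ⟩
    wedge (M zero) ψ S + wedge (M zero) φ S + a zero * (wedge ρ ψ S + wedge ρ φ S)
      ≈⟨ +-congˡ (*-congˡ (≈.trans (+-congˡ (ρ∧variation (M ∘ suc) (a ∘ suc) ρ S)) (+-identityʳ _))) ⟩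
    wedge (M zero) ψ S + wedge (M zero) φ S + a zero * wedge ρ ψ S   ≈⟨ +-assoc _ _ _ ⟩
    wedge (M zero) ψ S + (wedge (M zero) φ S + a zero * wedge ρ ψ S) ∎
    where
    Ψ = rowProduct (λ i j → M (suc i) j + a (suc i) * ρ j)
    φ = variation (M ∘ suc) (a ∘ suc) ρ
    ψ = rowProduct (M ∘ suc)
    split : ∀ r → wedge r Ψ S ≈ wedge r ψ S + wedge r φ S
    split r = ≈.trans (wedge-cong (λ _ → ≈.refl) (rowProduct-update (M ∘ suc) (a ∘ suc) ρ) S) (wedge-+ʳ r ψ φ S)

  -- The variation sums, over all rows, the product with that row replaced by ρ and weighted by `a`.
  -- For ρ = `M i`, every replacement except the one in place `i` repeats a row.
  variation-row : ∀ {l k} (M : Rows l k) a i → variation M a (M i) ≋ λ S → a i * rowProduct M S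
  variation-row M a zero    S = ≈.trans (+-congʳ (ρ∧variation (M ∘ suc) (a ∘ suc) (M zero) S)) (+-identityˡ _)
  variation-row M a (suc i) S = begin
    wedge (M zero) (variation (M ∘ suc) (a ∘ suc) (M (suc i))) S + a zero * wedge (M (suc i)) ψ S
      ≈⟨ +-cong (wedge-cong (λ _ → ≈.refl) (variation-row (M ∘ suc) (a ∘ suc) i) S) (*-congˡ (row∧rowProduct (M ∘ suc) i S)) ⟩
    wedge (M zero) (λ T → a (suc i) * ψ T) S + a zero * 0#   ≈⟨ +-cong (wedge-*ʳ (M zero) (a (suc i)) ψ S) (zeroʳ _) ⟩
    a (suc i) * wedge (M zero) ψ S + 0#                      ≈⟨ +-identityʳ _ ⟩
    a (suc i) * wedge (M zero) ψ S                           ∎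
    where ψ = rowProduct (M ∘ suc)

  variation-+* : ∀ {l k} (M : Rows l k) a ρ b σ →
    variation M a (λ j → ρ j + b * σ j) ≋ λ S → variation M a ρ S + b * variation M a σ S
  variation-+* {zero}  M a ρ b σ S = solve 1 (λ b → con (+ 0) := con (+ 0) :+ b :* con (+ 0)) ≈.refl b
  variation-+* {suc l} M a ρ b σ S = begin
    wedge (M zero) (V (λ j → ρ j + b * σ j)) S + a zero * wedge (λ j → ρ j + b * σ j) ψ S
      ≈⟨ +-cong (wedge-cong (λ _ → ≈.refl) (variation-+* (M ∘ suc) (a ∘ suc) ρ b σ) S) (*-congˡ (wedge-+* ρ σ b ψ S)) ⟩
    wedge (M zero) (λ T → V ρ T + b * V σ T) S + a zero * (wedge ρ ψ S + b * wedge σ ψ S)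
      ≈⟨ +-congʳ (≈.trans (wedge-+ʳ (M zero) (V ρ) _ S) (+-congˡ (wedge-*ʳ (M zero) b (V σ) S))) ⟩
    wedge (M zero) (V ρ) S + b * wedge (M zero) (V σ) S + a zero * (wedge ρ ψ S + b * wedge σ ψ S)
      ≈⟨ solve 6 (λ p b q a x y → (p :+ b :* q) :+ a :* (x :+ b :* y) := (p :+ a :* x) :+ b :* (q :+ a :* y)) ≈.refl
           (wedge (M zero) (V ρ) S) b (wedge (M zero) (V σ) S) (a zero) _ _ ⟩
    (wedge (M zero) (V ρ) S + a zero * wedge ρ ψ S) + b * (wedge (M zero) (V σ) S + a zero * wedge σ ψ S) ∎
    where
    ψ = rowProduct (M ∘ suc)
    V = variation (M ∘ suc) (a ∘ suc)

  variation-zero : ∀ {l k} (M : Rows l k) a S → variation M a (λ _ → 0#) S ≈ 0#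
  variation-zero M a S = begin
    variation M a (λ _ → 0#) S                                     ≈⟨ variation-cong M a (λ _ → solve 0 (con (+ 0) := con (+ 0) :+ con -[1+ 0 ] :* con (+ 0)) ≈.refl) S ⟩
    variation M a (λ _ → 0# + - 1# * 0#) S                         ≈⟨ variation-+* M a (λ _ → 0#) (- 1#) (λ _ → 0#) S ⟩
    variation M a (λ _ → 0#) S + - 1# * variation M a (λ _ → 0#) S ≈⟨ solve 1 (λ x → x :+ con -[1+ 0 ] :* x := con (+ 0)) ≈.refl _ ⟩
    0#                                                             ∎

  variation-sum : ∀ {l k m} (M : Rows l k) a (b : Fin m → Carrier) (σ : Rows m k) →
    variation M a (λ j → sum λ i → b i * σ i j) ≋ λ S → sum λ i → b i * variation M a (σ i) S
  variation-sum {m = zero}  M a b σ S = variation-zero M a S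
  variation-sum {m = suc m} M a b σ S = begin
    variation M a (λ j → b zero * σ zero j + rest j) S           ≈⟨ variation-cong M a (λ j → +-comm _ _) S ⟩
    variation M a (λ j → rest j + b zero * σ zero j) S           ≈⟨ variation-+* M a rest (b zero) (σ zero) S ⟩
    variation M a rest S + b zero * variation M a (σ zero) S     ≈⟨ +-comm _ _ ⟩
    b zero * variation M a (σ zero) S + variation M a rest S     ≈⟨ +-congˡ (variation-sum M a (b ∘ suc) (σ ∘ suc) S) ⟩
    b zero * variation M a (σ zero) S + (sum λ i → b (suc i) * variation M a (σ (suc i)) S) ∎
    where
    rest : Fin _ → Carrier
    rest j = sum λ i → b (suc i) * σ (suc i) j

  -- The matrix determinant lemma, free of division by μ.
  rowProduct-rankOne : ∀ {l k} (M : Rows l k) a b ρ μ → (∀ j → sum (λ i → b i * M i j) ≈ μ * ρ j) →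
    ∀ S → μ * rowProduct (λ i j → M i j + a i * ρ j) S ≈ (μ + a ∙ b) * rowProduct M S
  rowProduct-rankOne M a b ρ μ eq S = begin
    μ * rowProduct (λ i j → M i j + a i * ρ j) S       ≈⟨ *-congˡ (rowProduct-update M a ρ S) ⟩
    μ * (rowProduct M S + variation M a ρ S)           ≈⟨ distribˡ μ _ _ ⟩
    μ * rowProduct M S + μ * variation M a ρ S         ≈⟨ +-congˡ (+-identityˡ _) ⟨
    μ * rowProduct M S + (0# + μ * variation M a ρ S)  ≈⟨ +-congˡ (+-congʳ (variation-zero M a S)) ⟨
    μ * rowProduct M S + (variation M a (λ _ → 0#) S + μ * variation M a ρ S)
      ≈⟨ +-congˡ (variation-+* M a (λ _ → 0#) μ ρ S) ⟨
    μ * rowProduct M S + variation M a (λ j → 0# + μ * ρ j) S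
      ≈⟨ +-congˡ (variation-cong M a (λ j → ≈.trans (+-identityˡ _) (≈.sym (eq j))) S) ⟩
    μ * rowProduct M S + variation M a (λ j → sum λ i → b i * M i j) S
      ≈⟨ +-congˡ (variation-sum M a b M S) ⟩
    μ * rowProduct M S + (sum λ i → b i * variation M a (M i) S)
      ≈⟨ +-congˡ (sum-cong-≋ λ i → ≈.trans (*-congˡ (variation-row M a i S))
           (solve 3 (λ b a x → b :* (a :* x) := (a :* b) :* x) ≈.refl (b i) (a i) _)) ⟩
    μ * rowProduct M S + (sum λ i → a i * b i * rowProduct M S)
      ≈⟨ +-congˡ (*-distribʳ-sum _ (λ i → a i * b i)) ⟨
    μ * rowProduct M S + (a ∙ b) * rowProduct M S      ≈⟨ distribʳ _ μ _ ⟨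
    (μ + a ∙ b) * rowProduct M S                       ∎

  -- The monomial e₀ ∧ ... ∧ eₖ₋₁, whose coefficient in the product of k rows is the determinant.
  top : ∀ {k} → Vec Bool k
  top = replicate _ true

  -- The coefficient of a monomial without eⱼ only involves coefficients of monomials without eⱼ, so
  -- column `j` can be deleted throughout. This produces the minors of the Laplace expansion.
  wedge-insertAt : ∀ {k} (r : Fin (suc k) → Carrier) φ j S →
    wedge r φ (insertAt S j false) ≈ wedge (r ∘ punchIn j) (λ T → φ (insertAt T j false)) S
  wedge-insertAt r φ zero    S           = ≈.refl
  wedge-insertAt r φ (suc j) (false ∷ S) = wedge-insertAt (r ∘ suc) (φ ∘ (false ∷_)) j S
  wedge-insertAt r φ (suc j) (true  ∷ S) = +-congˡ (-‿cong (wedge-insertAt (r ∘ suc) (φ ∘ (true ∷_)) j S))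

  one-insertAt : ∀ {k} (j : Fin (suc k)) S → one (insertAt S j false) ≡ one S
  one-insertAt zero    S           = ≡.refl
  one-insertAt (suc j) (false ∷ S) = one-insertAt j S
  one-insertAt (suc j) (true  ∷ S) = ≡.refl

  rowProduct-insertAt : ∀ {l k} (M : Rows l (suc k)) j S →
    rowProduct M (insertAt S j false) ≈ rowProduct (λ i → M i ∘ punchIn j) S
  rowProduct-insertAt {zero}  M j S = ≈.reflexive (one-insertAt j S)
  rowProduct-insertAt {suc l} M j S = ≈.trans (wedge-insertAt (M zero) _ j S)
    (wedge-cong (λ _ → ≈.refl) (rowProduct-insertAt (M ∘ suc) j) S)

  -- The full monomial arises by taking eⱼ from `r` and all the others from `φ`; the sign counts the
  -- j basis vectors that eⱼ has to pass.
  wedge-top : ∀ {k} (r : Fin (suc k) → Carrier) φ →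
    wedge r φ top ≈ sum λ j → sign 𝔽 (toℕ j) * r j * φ (insertAt top j false)
  wedge-top {zero}  r φ = +-cong (*-congʳ (≈.sym (*-identityˡ (r zero)))) -0#≈0#
  wedge-top {suc k} r φ = +-cong (*-congʳ (≈.sym (*-identityˡ (r zero)))) (begin
    - wedge (r ∘ suc) (φ ∘ (true ∷_)) top   ≈⟨ -‿cong (wedge-top (r ∘ suc) (φ ∘ (true ∷_))) ⟩
    - sum term                              ≈⟨ solve 1 (λ x → :- x := con -[1+ 0 ] :* x) ≈.refl _ ⟩
    - 1# * sum term                         ≈⟨ *-distribˡ-sum (- 1#) term ⟩
    (sum λ j → - 1# * term j)
      ≈⟨ sum-cong-≋ (λ j → solve 3 (λ s x y → con -[1+ 0 ] :* (s :* x :* y) := (:- s) :* x :* y) ≈.refl (sign 𝔽 (toℕ j)) (r (suc j)) (φ (true ∷ insertAt top j false))) ⟩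
    (sum λ j → - sign 𝔽 (toℕ j) * r (suc j) * φ (true ∷ insertAt top j false)) ∎)
    where
    term : Fin (suc k) → Carrier
    term j = sign 𝔽 (toℕ j) * r (suc j) * φ (true ∷ insertAt top j false)

  -- Laplace expansion singles out the first row, whereas the wedge product is alternating and
  -- multilinear in all rows alike; the later arguments work on that side.
  det≈rowProduct : ∀ {k} (M : Matrix 𝔽 k) → det 𝔽 M ≈ rowProduct M top
  det≈rowProduct {zero}  M = ≈.refl
  det≈rowProduct {suc k} M = ≈.sym (≈.trans (wedge-top (M zero) (rowProduct (M ∘ suc)))
    (sum-cong-≋ λ j → *-congˡ {sign 𝔽 (toℕ j) * M zero j} (≈.trans (rowProduct-insertAt (M ∘ suc) j top)
      (≈.sym (det≈rowProduct (λ i → M (suc i) ∘ punchIn j))))))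

-- Kernels of singular matrices by Gaussian elimination.

module LinearSystems {c ℓ₁ ℓ₂} (𝔽 : OrderedField c ℓ₁ ℓ₂) where
  open OrderedFieldProperties 𝔽
  open ExteriorAlgebra 𝔽

  Kernel : ∀ {l k} → Rows l k → Set (c ⊔ ℓ₁)
  Kernel M = ∃ λ z → NonZero z × (∀ i → M i ∙ z ≈ 0#)

  -- If column zero vanishes, e₀ occurs in no factor, hence in no monomial of the product.
  rowProduct-true : ∀ {l k} (M : Rows l (suc k)) → (∀ i → M i zero ≈ 0#) →
    ∀ S → rowProduct M (true ∷ S) ≈ 0#
  rowProduct-true {zero}  M col S = ≈.refl
  rowProduct-true {suc l} M col S = begin
    M zero zero * φ (false ∷ S) - wedge (M zero ∘ suc) (φ ∘ (true ∷_)) S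
      ≈⟨ +-cong (*-congʳ (col zero)) (-‿cong (wedge-zeroʳ (M zero ∘ suc) (rowProduct-true (M ∘ suc) (col ∘ suc)) S)) ⟩
    0# * φ (false ∷ S) - 0#
      ≈⟨ solve 1 (λ x → con (+ 0) :* x :- con (+ 0) := con (+ 0)) ≈.refl (φ (false ∷ S)) ⟩
    0#  ∎
    where φ = rowProduct (M ∘ suc)

  rowProduct-false : ∀ {l k} (M : Rows l (suc k)) S →
    rowProduct M (false ∷ S) ≈ rowProduct (λ i → M i ∘ suc) S
  rowProduct-false {zero}  M S = ≈.refl
  rowProduct-false {suc l} M S = wedge-cong (λ _ → ≈.refl) (rowProduct-false (M ∘ suc)) S

  mutual
    -- Adding multiples of the pivot row `p` to the other rows leaves `p` ∧ (their product)
    -- unchanged. Once column zero is cleared, the remaining k by k block is singular, and a kernel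
    -- vector of it extends by back substitution.
    eliminate : ∀ {k} (p : Fin (suc k) → Carrier) (R : Rows k (suc k)) → ¬ p zero ≈ 0# →
      wedge p (rowProduct R) top ≈ 0# → ∃ λ z → NonZero z × p ∙ z ≈ 0# × (∀ i → R i ∙ z ≈ 0#)
    eliminate {k} p R p₀≉0 singular with inverse (p zero) p₀≉0
    ... | q , p₀q≈1 = z , (suc j , z′ⱼ≉0) , p∙z , R∙z
      where
      a : Fin k → Carrier
      a i = - (R i zero * q)

      R′ : Rows k (suc k)
      R′ i j = R i j + a i * p j

      R′-column : ∀ i → R′ i zero ≈ 0#
      R′-column i = begin
        R i zero + - (R i zero * q) * p zero
          ≈⟨ solve 3 (λ r q p → r :+ (:- (r :* q)) :* p := r :* (con (+ 1) :- p :* q)) ≈.refl (R i zero) q (p zero) ⟩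
        R i zero * (1# - p zero * q)  ≈⟨ *-congˡ (x≈y⇒x-y≈0 (≈.sym p₀q≈1)) ⟩
        R i zero * 0#                 ≈⟨ zeroʳ _ ⟩
        0#                            ∎

      -- Since e₀ occurs only in `p`, the top coefficient is `p zero` times the minor of the cleared
      -- rows, so the pivot can be cancelled.
      singular′ : rowProduct (λ i → R′ i ∘ suc) top ≈ 0#
      singular′ = cancel-nonzero p₀≉0 (begin
        p zero * rowProduct (λ i → R′ i ∘ suc) top   ≈⟨ *-congˡ (rowProduct-false R′ top) ⟨
        p zero * rowProduct R′ (false ∷ top)         ≈⟨ solve 1 (λ x → x := x :- con (+ 0)) ≈.refl (p zero * rowProduct R′ (false ∷ top)) ⟩
        p zero * rowProduct R′ (false ∷ top) - 0#    ≈⟨ +-congˡ (-‿cong (wedge-zeroʳ (p ∘ suc) (rowProduct-true R′ R′-column) top)) ⟨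
        wedge p (rowProduct R′) top                  ≈⟨ wedge-cong {r = p} (λ _ → ≈.refl) (rowProduct-update R a p) top ⟩
        wedge p (λ S → rowProduct R S + variation R a p S) top   ≈⟨ wedge-+ʳ p (rowProduct R) (variation R a p) top ⟩
        wedge p (rowProduct R) top + wedge p (variation R a p) top ≈⟨ +-cong singular (ρ∧variation R a p top) ⟩
        0# + 0#                                      ≈⟨ +-identityˡ 0# ⟩
        0#                                           ∎)

      kernel′ : Kernel (λ i → R′ i ∘ suc)
      kernel′ = singular⇒kernel _ singular′

      z′ = proj₁ kernel′
      j = proj₁ (proj₁ (proj₂ kernel′))
      z′ⱼ≉0 = proj₂ (proj₁ (proj₂ kernel′))
      y = (p ∘ suc) ∙ z′

      -- Back substitution: `q` inverts the pivot, and the first coordinate is the one that makes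
      -- `p ∙ z` vanish.
      z : Fin (suc k) → Carrier
      z zero    = - (q * y)
      z (suc i) = z′ i

      p∙z : p ∙ z ≈ 0#
      p∙z = begin
        p zero * - (q * y) + y    ≈⟨ solve 3 (λ p q y → p :* (:- (q :* y)) :+ y := y :* (con (+ 1) :- p :* q)) ≈.refl (p zero) q y ⟩
        y * (1# - p zero * q)     ≈⟨ *-congˡ (x≈y⇒x-y≈0 (≈.sym p₀q≈1)) ⟩
        y * 0#                    ≈⟨ zeroʳ _ ⟩
        0#                        ∎

      R∙z : ∀ i → R i ∙ z ≈ 0#
      R∙z i = begin
        R i zero * - (q * y) + (R i ∘ suc) ∙ z′
          ≈⟨ solve 4 (λ r q y x → r :* (:- (q :* y)) :+ x := x :+ (:- (r :* q)) :* y) ≈.refl (R i zero) q y ((R i ∘ suc) ∙ z′) ⟩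
        (R i ∘ suc) ∙ z′ + a i * y         ≈⟨ ∙-+*ˡ (R i ∘ suc) (a i) (p ∘ suc) z′ ⟨
        (R′ i ∘ suc) ∙ z′                  ≈⟨ proj₂ (proj₂ kernel′) i ⟩
        0#                                 ∎

    singular⇒kernel : ∀ {k} (M : Rows k k) → rowProduct M top ≈ 0# → Kernel M
    singular⇒kernel {zero}  M 1≈0 = contradiction (≈.sym 1≈0) 0≉1
    singular⇒kernel {suc k} M singular with M zero zero ≈? 0# | any? (λ i → ¬? (M (suc i) zero ≈? 0#))
    ... | no M₀₀≉0  | _                = firstPivot M M₀₀≉0 singular
    ... | yes M₀₀≈0 | yes (i , Mᵢ₀≉0)  = laterPivot M M₀₀≈0 i Mᵢ₀≉0 singular
    -- Column zero vanishes altogether, so the first basis vector lies in the kernel.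
    ... | yes M₀₀≈0 | no noPivot       = δ zero , (zero , λ 1≈0 → 0≉1 (≈.sym 1≈0)) , λ i →
            ≈.trans (∙-comm (M i) (δ zero)) (≈.trans (δ-∙ zero (M i)) (column i))
      where
      column : ∀ i → M i zero ≈ 0#
      column zero    = M₀₀≈0
      column (suc i) = decidable-stable (M (suc i) zero ≈? 0#) (λ Mᵢ₀≉0 → noPivot (i , Mᵢ₀≉0))

    firstPivot : ∀ {k} (M : Rows (suc k) (suc k)) → ¬ M zero zero ≈ 0# → rowProduct M top ≈ 0# → Kernel M
    firstPivot M M₀₀≉0 singular =
      let z , z≉0 , M₀∙z , R∙z = eliminate (M zero) (M ∘ suc) M₀₀≉0 singular
      in z , z≉0 , λ { zero → M₀∙z ; (suc i) → R∙z i }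

    -- Instead of exchanging rows, the row with the pivot is added to row zero. The top coefficient
    -- does not change, because the added term repeats a row.
    laterPivot : ∀ {k} (M : Rows (suc k) (suc k)) → M zero zero ≈ 0# → ∀ i → ¬ M (suc i) zero ≈ 0# →
      rowProduct M top ≈ 0# → Kernel M
    laterPivot {k} M M₀₀≈0 i Mᵢ₀≉0 singular =
      let z , z≉0 , p∙z , R∙z = eliminate p (M ∘ suc) p₀≉0 singular′
      in z , z≉0 , λ { zero → M₀∙z z p∙z (R∙z i) ; (suc j) → R∙z j }
      where
      p : Fin (suc k) → Carrier
      p j = M zero j + 1# * M (suc i) j

      p₀≉0 : ¬ p zero ≈ 0#
      p₀≉0 p₀≈0 = Mᵢ₀≉0 (begin
        M (suc i) zero                            ≈⟨ solve 1 (λ x → x := con (+ 0) :+ con (+ 1) :* x) ≈.refl (M (suc i) zero) ⟩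
        0# + 1# * M (suc i) zero                  ≈⟨ +-congʳ M₀₀≈0 ⟨
        p zero                                    ≈⟨ p₀≈0 ⟩
        0#                                        ∎)

      singular′ : wedge p (rowProduct (M ∘ suc)) top ≈ 0#
      singular′ = begin
        wedge p (rowProduct (M ∘ suc)) top        ≈⟨ wedge-+* (M zero) (M (suc i)) 1# (rowProduct (M ∘ suc)) top ⟩
        rowProduct M top + 1# * wedge (M (suc i)) (rowProduct (M ∘ suc)) top
          ≈⟨ +-cong singular (*-congˡ (row∧rowProduct (M ∘ suc) i top)) ⟩
        0# + 1# * 0#                              ≈⟨ solve 0 (con (+ 0) :+ con (+ 1) :* con (+ 0) := con (+ 0)) ≈.refl ⟩
        0#                                        ∎

      M₀∙z : ∀ z → p ∙ z ≈ 0# → M (suc i) ∙ z ≈ 0# → M zero ∙ z ≈ 0#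
      M₀∙z z p∙z Mᵢ∙z = begin
        M zero ∙ z                                ≈⟨ solve 2 (λ x y → x := (x :+ con (+ 1) :* y) :- y) ≈.refl (M zero ∙ z) (M (suc i) ∙ z) ⟩
        (M zero ∙ z + 1# * M (suc i) ∙ z) - M (suc i) ∙ z   ≈⟨ +-cong (≈.sym (∙-+*ˡ (M zero) 1# (M (suc i)) z)) (-‿cong Mᵢ∙z) ⟩
        p ∙ z - 0#                                ≈⟨ +-congʳ p∙z ⟩
        0# - 0#                                   ≈⟨ -‿inverseʳ 0# ⟩
        0#                                        ∎

  det≈0⇒kernel : ∀ {k} (M : Matrix 𝔽 k) → det 𝔽 M ≈ 0# → Kernel M
  det≈0⇒kernel M det≈0 = singular⇒kernel M (≈.trans (≈.sym (det≈rowProduct M)) det≈0)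

  -- A zero row on top makes the system square and visibly singular.
  underdetermined : ∀ {k} (M : Rows k (suc k)) → Kernel M
  underdetermined {k} M =
    let z , z≉0 , M⁺∙z = singular⇒kernel M⁺ (wedge-zeroˡ (rowProduct M) top) in z , z≉0 , M⁺∙z ∘ suc
    where
    M⁺ : Rows (suc k) (suc k)
    M⁺ zero    j = 0#
    M⁺ (suc i) j = M i j

-- Polynomial functions and their roots.

module PolynomialFunctions {c ℓ₁ ℓ₂} (𝔽 : OrderedField c ℓ₁ ℓ₂) where
  open OrderedFieldProperties 𝔽

  -- A spectrum is specified by values of the characteristic polynomial, so a polynomial is a
  -- function with evidence of a Horner form. The index is only an upper bound for the degree:
  -- `constant` is available at every `d`.
  data Polynomial : ℕ → (Carrier → Carrier) → Set (c ⊔ ℓ₁) where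
    constant : ∀ {d f} a → (∀ x → f x ≈ a) → Polynomial d f
    horner   : ∀ {d f g} a → Polynomial d g → (∀ x → f x ≈ a + x * g x) → Polynomial (suc d) f

  polynomial-cong : ∀ {d f} → Polynomial d f → ∀ {x y} → x ≈ y → f x ≈ f y
  polynomial-cong (constant a f≈) x≈y = ≈.trans (f≈ _) (≈.sym (f≈ _))
  polynomial-cong (horner a p f≈) x≈y =
    ≈.trans (f≈ _) (≈.trans (+-congˡ (*-cong x≈y (polynomial-cong p x≈y))) (≈.sym (f≈ _)))

  polynomial-resp : ∀ {d f g} → (∀ x → g x ≈ f x) → Polynomial d f → Polynomial d g
  polynomial-resp g≈f (constant a f≈) = constant a (λ x → ≈.trans (g≈f x) (f≈ x))
  polynomial-resp g≈f (horner a p f≈) = horner a p (λ x → ≈.trans (g≈f x) (f≈ x))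

  weaken : ∀ {d f} e → Polynomial d f → Polynomial (e ℕ.+ d) f
  weaken zero    p = p
  weaken (suc e) p = raise (weaken e p)
    where
    raise : ∀ {d f} → Polynomial d f → Polynomial (suc d) f
    raise (constant a f≈) = constant a f≈
    raise (horner a p f≈) = horner a (raise p) f≈

  polynomial-* : ∀ {d f} b → Polynomial d f → Polynomial d (λ x → b * f x)
  polynomial-* b (constant a f≈) = constant (b * a) (λ x → *-congˡ (f≈ x))
  polynomial-* b (horner {g = g} a p f≈) = horner (b * a) (polynomial-* b p) (λ x → ≈.trans (*-congˡ (f≈ x))
    (solve 4 (λ a b x y → b :* (a :+ x :* y) := b :* a :+ x :* (b :* y)) ≈.refl a b x (g x)))

  polynomial-+ : ∀ {d f g} → Polynomial d f → Polynomial d g → Polynomial d (λ x → f x + g x)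
  polynomial-+ (constant a f≈) (constant b g≈) = constant (a + b) (λ x → +-cong (f≈ x) (g≈ x))
  polynomial-+ (constant a f≈) (horner b q g≈) = horner (a + b) q
    (λ x → ≈.trans (+-cong (f≈ x) (g≈ x)) (≈.sym (+-assoc _ _ _)))
  polynomial-+ (horner {g = f′} a p f≈) (constant b g≈) = horner (a + b) p
    (λ x → ≈.trans (+-cong (f≈ x) (g≈ x)) (solve 3 (λ a b y → (a :+ y) :+ b := (a :+ b) :+ y) ≈.refl a b (x * f′ x)))
  polynomial-+ (horner {g = f′} a p f≈) (horner {g = g′} b q g≈) = horner (a + b) (polynomial-+ p q)
    (λ x → ≈.trans (+-cong (f≈ x) (g≈ x))
      (solve 5 (λ a b x y z → (a :+ x :* y) :+ (b :+ x :* z) := (a :+ b) :+ x :* (y :+ z)) ≈.refl a b x (f′ x) (g′ x)))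

  polynomial-product : ∀ {d e f g} → Polynomial d f → Polynomial e g → Polynomial (d ℕ.+ e) (λ x → f x * g x)
  polynomial-product {d} (constant a f≈) q = polynomial-resp (λ x → *-congʳ (f≈ x)) (weaken d (polynomial-* a q))
  polynomial-product {suc d} {g = g} (horner {g = f′} a p f≈) q = polynomial-resp
    (λ x → ≈.trans (*-congʳ (f≈ x))
      (solve 4 (λ a x y z → (a :+ x :* y) :* z := a :* z :+ (con (+ 0) :+ x :* (y :* z))) ≈.refl a x (f′ x) (g x)))
    (polynomial-+ (weaken (suc d) (polynomial-* a q)) (horner 0# (polynomial-product p q) (λ x → ≈.refl)))

  polynomial-sum : ∀ {d k} {f : Fin k → Carrier → Carrier} → (∀ i → Polynomial d (f i)) → Polynomial d (λ x → sum λ i → f i x)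
  polynomial-sum {k = zero}  p = constant 0# (λ _ → ≈.refl)
  polynomial-sum {k = suc k} p = polynomial-+ (p zero) (polynomial-sum (p ∘ suc))

  polynomial-linear : ∀ a b → Polynomial 1 (λ x → a * x + b)
  polynomial-linear a b = horner b (constant a λ _ → ≈.refl)
    (λ x → solve 3 (λ a b x → a :* x :+ b := b :+ x :* a) ≈.refl a b x)

  polynomial-det : ∀ {k} {M : Fin k → Fin k → Carrier → Carrier} → (∀ i j → Polynomial 1 (M i j)) →
    Polynomial k (λ x → det 𝔽 (λ i j → M i j x))
  polynomial-det {zero}  p = constant 1# (λ _ → ≈.refl)
  polynomial-det {suc k} p = polynomial-sum λ j →
    polynomial-product (polynomial-* (sign 𝔽 (toℕ j)) (p zero j)) (polynomial-det (λ i l → p (suc i) (punchIn j l)))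

  divide : ∀ {d f} → Polynomial (suc d) f → ∀ a → ∃ λ q → Polynomial d q × (∀ x → f x ≈ f a + (x - a) * q x)
  divide (constant b f≈) a = (λ _ → 0#) , constant 0# (λ _ → ≈.refl) , λ x →
    ≈.trans (f≈ x) (≈.trans (≈.sym (f≈ a)) (solve 3 (λ x a b → b := b :+ (x :- a) :* con (+ 0)) ≈.refl x a _))
  divide (horner {g = g} b (constant e g≈) f≈) a = g , constant e g≈ , λ x → begin
    _                               ≈⟨ f≈ x ⟩
    b + x * g x                     ≈⟨ solve 4 (λ b x a y → b :+ x :* y := (b :+ a :* y) :+ (x :- a) :* y) ≈.refl b x a (g x) ⟩
    (b + a * g x) + (x - a) * g x   ≈⟨ +-congʳ (+-congˡ (*-congˡ (≈.trans (g≈ x) (≈.sym (g≈ a))))) ⟩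
    (b + a * g a) + (x - a) * g x   ≈⟨ +-congʳ (f≈ a) ⟨
    _                               ∎
  divide (horner {g = g} b p@(horner _ _ _) f≈) a =
    let q , q-polynomial , g≈ = divide p a in
    -- Synthetic division: for f = b + x g and g = g(a) + (x - a) q, the quotient of f by x - a is g
    -- + a q.
    (λ x → g x + a * q x) , polynomial-+ p (polynomial-* a (weaken 1 q-polynomial)) , λ x → begin
      _                                               ≈⟨ f≈ x ⟩
      b + x * g x                                     ≈⟨ solve 4 (λ b x a y → b :+ x :* y := (b :+ a :* y) :+ (x :- a) :* y) ≈.refl b x a (g x) ⟩
      (b + a * g x) + (x - a) * g x                   ≈⟨ +-congʳ (+-congˡ (*-congˡ (g≈ x))) ⟩
      (b + a * (g a + (x - a) * q x)) + (x - a) * g x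
        ≈⟨ solve 6 (λ b a x u v y → (b :+ a :* (u :+ (x :- a) :* v)) :+ (x :- a) :* y :=
             (b :+ a :* u) :+ (x :- a) :* (y :+ a :* v)) ≈.refl b a x (g a) (q x) (g x) ⟩
      (b + a * g a) + (x - a) * (g x + a * q x)       ≈⟨ +-congʳ (f≈ a) ⟨
      _                                               ∎

  -- Dividing by x - b lowers the degree bound, and the quotient keeps the roots b + 1, b + 2, ...,
  -- which differ from b. An infinite progression of roots spares counting them against the degree.
  roots⇒zero : ∀ {d f} → Polynomial d f → ∀ b → (∀ k → f (b + fromℕ k) ≈ 0#) → ∀ x → f x ≈ 0#
  roots⇒zero (constant a f≈) b root x = ≈.trans (f≈ x) (≈.trans (≈.sym (f≈ _)) (root 0))
  roots⇒zero {suc d} {f} p@(horner _ _ _) b root x =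
    let q , q-polynomial , f≈ = divide p (b + fromℕ 0)
        q-root : ∀ k → q ((b + 1#) + fromℕ k) ≈ 0#
        q-root k = cancel-nonzero {y = q ((b + 1#) + fromℕ k)} (difference≉0 k) (begin
          ((b + 1#) + fromℕ k - (b + 0#)) * q ((b + 1#) + fromℕ k)    ≈⟨ +-identityˡ _ ⟨
          0# + _                                                      ≈⟨ +-congʳ (root 0) ⟨
          f (b + 0#) + _                                              ≈⟨ f≈ _ ⟨
          f ((b + 1#) + fromℕ k)                                      ≈⟨ polynomial-cong p (+-assoc b 1# (fromℕ k)) ⟩
          f (b + fromℕ (suc k))                                       ≈⟨ root (suc k) ⟩
          0#                                                          ∎)
    in begin
      f x                                   ≈⟨ f≈ x ⟩
      f (b + 0#) + (x - (b + 0#)) * q x     ≈⟨ +-cong (root 0) (*-congˡ (roots⇒zero q-polynomial (b + 1#) q-root x)) ⟩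
      0# + (x - (b + 0#)) * 0#              ≈⟨ solve 1 (λ y → con (+ 0) :+ y :* con (+ 0) := con (+ 0)) ≈.refl (x - (b + 0#)) ⟩
      0#                                    ∎
    where
    difference≉0 : ∀ k → ¬ (b + 1#) + fromℕ k - (b + 0#) ≈ 0#
    difference≉0 k eq = fromℕ-suc≰ k (≤-trans (≤-reflexive (≈.trans
      (solve 2 (λ b y → con (+ 1) :+ y := ((b :+ con (+ 1)) :+ y) :- (b :+ con (+ 0))) ≈.refl b (fromℕ k)) eq))
      (fromℕ-nonNegative k))

  -- The points a + 1, a + 2, ... all differ from `a`. The purpose is to cancel a factor x - a from
  -- an identity of polynomials, also at x = a.
  polynomial-ext : ∀ {d f g} → Polynomial d f → Polynomial d g → ∀ a → (∀ x → ¬ x - a ≈ 0# → f x ≈ g x) → ∀ x → f x ≈ g x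
  polynomial-ext {f = f} {g} p q a agree x = x-y≈0⇒x≈y (≈.trans (+-congˡ (negate (g x)))
    (roots⇒zero (polynomial-+ p (polynomial-* (- 1#) q)) (a + 1#)
      (λ k → ≈.trans (+-congˡ (≈.sym (negate (g (a + 1# + fromℕ k))))) (x≈y⇒x-y≈0 (agree _ (difference≉0 k)))) x))
    where
    negate : ∀ y → - y ≈ - 1# * y
    negate = solve 1 (λ y → :- y := con -[1+ 0 ] :* y) ≈.refl

    difference≉0 : ∀ k → ¬ (a + 1#) + fromℕ k - a ≈ 0#
    difference≉0 k eq = fromℕ-suc≰ k (≤-trans (≤-reflexive (≈.trans
      (solve 2 (λ a y → con (+ 1) :+ y := ((a :+ con (+ 1)) :+ y) :- a) ≈.refl a (fromℕ k)) eq))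
      (fromℕ-nonNegative k))

-- Orthogonal eigenvectors of a symmetric matrix by deflation.

module SymmetricMatrices {c ℓ₁ ℓ₂} (𝔽 : OrderedField c ℓ₁ ℓ₂) where
  open OrderedFieldProperties 𝔽
  open ExteriorAlgebra 𝔽
  open LinearSystems 𝔽
  open PolynomialFunctions 𝔽

  Symmetric : ∀ {n} → Matrix 𝔽 n → Set ℓ₁
  Symmetric M = ∀ i j → M i j ≈ M j i

  Eigenvector : ∀ {n} → Matrix 𝔽 n → Carrier → (Fin n → Carrier) → Set ℓ₁
  Eigenvector M μ v = ∀ i → M i ∙ v ≈ μ * v i

  self-adjoint : ∀ {n} {M : Matrix 𝔽 n} → Symmetric M → ∀ x y → x ∙ (λ i → M i ∙ y) ≈ y ∙ (λ i → M i ∙ x)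
  self-adjoint {M = M} M-sym x y = begin
    (sum λ i → x i * M i ∙ y)                     ≈⟨ sum-cong-≋ (λ i → *-distribˡ-sum (x i) (λ j → M i j * y j)) ⟩
    (sum λ i → sum λ j → x i * (M i j * y j))     ≈⟨ ∑-comm (λ i j → x i * (M i j * y j)) ⟩
    (sum λ j → sum λ i → x i * (M i j * y j))     ≈⟨ sum-cong-≋ (λ j → sum-cong-≋ λ i → swap i j) ⟩
    (sum λ j → sum λ i → y j * (M j i * x i))     ≈⟨ sum-cong-≋ (λ j → *-distribˡ-sum (y j) (λ i → M j i * x i)) ⟨
    (sum λ j → y j * M j ∙ x)                     ∎
    where
    swap : ∀ i j → x i * (M i j * y j) ≈ y j * (M j i * x i)
    swap i j = ≈.trans (*-congˡ (*-congʳ (M-sym i j)))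
      (solve 3 (λ x m y → x :* (m :* y) := y :* (m :* x)) ≈.refl (x i) (M j i) (y j))

  eigenvector-form : ∀ {n} {M : Matrix 𝔽 n} {μ v} → Eigenvector M μ v → ∀ x → x ∙ (λ i → M i ∙ v) ≈ μ * x ∙ v
  eigenvector-form {μ = μ} {v} Mv x = ≈.trans (∙-cong {w = x} (λ _ → ≈.refl) Mv) (∙-*ʳ μ x v)

  eigenvectors-orthogonal : ∀ {n} {M : Matrix 𝔽 n} {μ ν u v} → Symmetric M →
    Eigenvector M μ u → Eigenvector M ν v → ¬ μ ≈ ν → u ∙ v ≈ 0#
  eigenvectors-orthogonal {M = M} {μ} {ν} {u} {v} M-sym Mu Mv μ≉ν =
    cancel-nonzero (λ μ-ν≈0 → μ≉ν (x-y≈0⇒x≈y μ-ν≈0)) (begin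
      (μ - ν) * u ∙ v             ≈⟨ solve 3 (λ μ ν x → (μ :- ν) :* x := μ :* x :- ν :* x) ≈.refl μ ν (u ∙ v) ⟩
      μ * u ∙ v - ν * u ∙ v       ≈⟨ +-congʳ (*-congˡ (∙-comm u v)) ⟩
      μ * v ∙ u - ν * u ∙ v       ≈⟨ x≈y⇒x-y≈0 (begin
        μ * v ∙ u                 ≈⟨ eigenvector-form {M = M} Mu v ⟨
        v ∙ (λ i → M i ∙ u)       ≈⟨ self-adjoint M-sym v u ⟩
        u ∙ (λ i → M i ∙ v)       ≈⟨ eigenvector-form {M = M} Mv u ⟩
        ν * u ∙ v                 ∎) ⟩
      0#                          ∎)

  characteristic : ∀ {n} → Matrix 𝔽 n → Carrier → Matrix 𝔽 n
  characteristic M x i j = diagonal 𝔽 (λ _ → x) i j - M i j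

  diagonal-δ : ∀ {n} (d : Fin n → Carrier) (i j : Fin n) → diagonal 𝔽 d i j ≈ d i * δ i j
  diagonal-δ d i j with does (i ≟ j)
  ... | true  = ≈.sym (*-identityʳ (d i))
  ... | false = ≈.sym (zeroʳ (d i))

  diagonal-∙ : ∀ {n} (d : Fin n → Carrier) i v → diagonal 𝔽 d i ∙ v ≈ d i * v i
  diagonal-∙ d i v = begin
    diagonal 𝔽 d i ∙ v          ≈⟨ ∙-cong {y = v} (diagonal-δ d i) (λ _ → ≈.refl) ⟩
    (λ j → d i * δ i j) ∙ v     ≈⟨ ∙-comm (λ j → d i * δ i j) v ⟩
    v ∙ (λ j → d i * δ i j)     ≈⟨ ∙-*ʳ (d i) v (δ i) ⟩
    d i * v ∙ δ i               ≈⟨ *-congˡ (≈.trans (∙-comm v (δ i)) (δ-∙ i v)) ⟩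
    d i * v i                   ∎

  diagonal-symmetric : ∀ {n} (d : Fin n → Carrier) → Symmetric (diagonal 𝔽 d)
  diagonal-symmetric d i j with i ≟ j | j ≟ i
  ... | yes i≡j | yes _   = ≈.reflexive (≡.cong d i≡j)
  ... | no _    | no _    = ≈.refl
  ... | yes i≡j | no j≢i  = contradiction (≡.sym i≡j) j≢i
  ... | no i≢j  | yes j≡i = contradiction (≡.sym j≡i) i≢j

  characteristic-∙ : ∀ {n} (M : Matrix 𝔽 n) x i v → characteristic M x i ∙ v ≈ x * v i - M i ∙ v
  characteristic-∙ M x i v = begin
    characteristic M x i ∙ v
      ≈⟨ ∙-cong {y = v} (λ j → solve 2 (λ d m → d :- m := d :+ con -[1+ 0 ] :* m) ≈.refl (diagonal 𝔽 (λ _ → x) i j) (M i j)) (λ _ → ≈.refl) ⟩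
    (λ j → diagonal 𝔽 (λ _ → x) i j + - 1# * M i j) ∙ v   ≈⟨ ∙-+*ˡ (diagonal 𝔽 (λ _ → x) i) (- 1#) (M i) v ⟩
    diagonal 𝔽 (λ _ → x) i ∙ v + - 1# * M i ∙ v
      ≈⟨ +-cong (diagonal-∙ (λ _ → x) i v) (solve 1 (λ y → con -[1+ 0 ] :* y := :- y) ≈.refl (M i ∙ v)) ⟩
    x * v i - M i ∙ v                                     ∎

  charPoly-polynomial : ∀ {n} (M : Matrix 𝔽 n) → Polynomial n (charPoly 𝔽 M)
  charPoly-polynomial M = polynomial-det λ i j → polynomial-resp
    (λ x → +-congʳ (≈.trans (diagonal-δ (λ _ → x) i j) (*-comm x (δ i j))))
    (polynomial-linear (δ i j) (- M i j))

  root⇒eigenvector : ∀ {n} (M : Matrix 𝔽 n) μ → charPoly 𝔽 M μ ≈ 0# → ∃ λ v → NonZero v × Eigenvector M μ v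
  root⇒eigenvector M μ root =
    let v , v≉0 , kernel = det≈0⇒kernel (characteristic M μ) root in
    v , v≉0 , λ i → ≈.sym (x-y≈0⇒x≈y (≈.trans (≈.sym (characteristic-∙ M μ i v)) (kernel i)))

  deflate : ∀ {n} → Matrix 𝔽 n → Carrier → (Fin n → Carrier) → Matrix 𝔽 n
  deflate M σ v i j = M i j + σ * v i * v j

  deflate-symmetric : ∀ {n} {M : Matrix 𝔽 n} σ v → Symmetric M → Symmetric (deflate M σ v)
  deflate-symmetric σ v M-sym i j = +-cong (M-sym i j)
    (solve 3 (λ s x y → s :* x :* y := s :* y :* x) ≈.refl σ (v i) (v j))

  deflate-∙ : ∀ {n} (M : Matrix 𝔽 n) σ v i w → deflate M σ v i ∙ w ≈ M i ∙ w + σ * v i * v ∙ w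
  deflate-∙ M σ v i w = ∙-+*ˡ (M i) (σ * v i) v w

  -- The characteristic matrix changes by the rank-one term -σ v vᵀ, and by symmetry `v` is also a
  -- left eigenvector of it, with eigenvalue x - μ. The determinant lemma then applies; the factor x
  -- - μ on the left keeps it free of division.
  charPoly-deflate : ∀ {n} {M : Matrix 𝔽 n} {μ v} → Symmetric M → Eigenvector M μ v → ∀ σ x →
    (x - μ) * charPoly 𝔽 (deflate M σ v) x ≈ (x - (μ + σ * v ∙ v)) * charPoly 𝔽 M x
  charPoly-deflate {M = M} {μ} {v} M-sym Mv σ x = begin
    (x - μ) * det 𝔽 (characteristic (deflate M σ v) x)            ≈⟨ *-congˡ (det≈rowProduct (characteristic (deflate M σ v) x)) ⟩
    (x - μ) * rowProduct (characteristic (deflate M σ v) x) top   ≈⟨ *-congˡ (rowProduct-cong rows top) ⟩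
    (x - μ) * rowProduct (λ i j → X i j + a i * v j) top          ≈⟨ rowProduct-rankOne X a v v (x - μ) combination top ⟩
    (x - μ + a ∙ v) * rowProduct X top                            ≈⟨ *-cong coefficient (≈.sym (det≈rowProduct X)) ⟩
    (x - (μ + σ * v ∙ v)) * det 𝔽 X                               ∎
    where
    X = characteristic M x

    a : Fin _ → Carrier
    a i = - σ * v i

    rows : ∀ i j → characteristic (deflate M σ v) x i j ≈ X i j + a i * v j
    rows i j = solve 5 (λ d m s x y → d :- (m :+ s :* x :* y) := (d :- m) :+ (:- s) :* x :* y) ≈.refl
      (diagonal 𝔽 (λ _ → x) i j) (M i j) σ (v i) (v j)

    combination : ∀ j → sum (λ i → v i * X i j) ≈ (x - μ) * v j
    combination j = begin
      sum (λ i → v i * X i j)   ≈⟨ sum-cong-≋ (λ i → ≈.trans (*-comm (v i) (X i j))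
                                     (*-congʳ (+-cong (diagonal-symmetric (λ _ → x) i j) (-‿cong (M-sym i j))))) ⟩
      X j ∙ v                   ≈⟨ characteristic-∙ M x j v ⟩
      x * v j - M j ∙ v         ≈⟨ +-congˡ (-‿cong (Mv j)) ⟩
      x * v j - μ * v j         ≈⟨ solve 3 (λ x μ y → x :* y :- μ :* y := (x :- μ) :* y) ≈.refl x μ (v j) ⟩
      (x - μ) * v j             ∎

    coefficient : x - μ + a ∙ v ≈ x - (μ + σ * v ∙ v)
    coefficient = begin
      x - μ + a ∙ v             ≈⟨ +-congˡ (≈.trans (∙-comm a v) (∙-*ʳ (- σ) v v)) ⟩
      x - μ + - σ * v ∙ v       ≈⟨ solve 4 (λ x μ s y → (x :- μ) :+ (:- s) :* y := x :- (μ :+ s :* y)) ≈.refl x μ σ (v ∙ v) ⟩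
      x - (μ + σ * v ∙ v)       ∎

  rootProduct : ∀ {k} → Vec Carrier k → Carrier → Carrier
  rootProduct μs x = foldr′ _*_ 1# (map (λ μ → x - μ) μs)

  rootProduct-polynomial : ∀ {k} (μs : Vec Carrier k) → Polynomial k (rootProduct μs)
  rootProduct-polynomial []       = constant 1# (λ _ → ≈.refl)
  rootProduct-polynomial (μ ∷ μs) = polynomial-product
    (polynomial-resp (λ x → +-congʳ (≈.sym (*-identityˡ x))) (polynomial-linear 1# (- μ))) (rootProduct-polynomial μs)

  -- The family is indexed by positions in the list, so a repeated root receives one vector for each
  -- occurrence. The vectors are non-zero but not of unit length.
  record OrthogonalEigenvectors {n k} (M : Matrix 𝔽 n) (μs : Fin k → Carrier) : Set (c ⊔ ℓ₁) where
    field
      vector      : Fin k → Fin n → Carrier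
      nonZero     : ∀ i → NonZero (vector i)
      eigenvector : ∀ i → Eigenvector M (μs i) (vector i)
      orthogonal  : ∀ i j → i ≢ j → vector i ∙ vector j ≈ 0#

  -- Wielandt deflation: once an eigenvector for μ is found, μ is moved to s, away from
  -- the eigenvalues still to be treated, whose eigenvectors are then orthogonal to it.
  deflation : ∀ {n k d} (M : Matrix 𝔽 n) → Symmetric M → ∀ {h} → Polynomial d h → (μs : Vec Carrier k) →
    ∀ s → (∀ i → ¬ s ≈ lookup μs i) → (∀ x → charPoly 𝔽 M x ≈ h x * rootProduct μs x) →
    OrthogonalEigenvectors M (lookup μs)
  deflation M M-sym {h} h-poly [] s s≉ factors = record
    { vector = λ () ; nonZero = λ () ; eigenvector = λ () ; orthogonal = λ () }
  deflation {n} {suc k} {d} M M-sym {h} h-poly (μ ∷ μs) s s≉ factors = record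
    { vector = vector′ ; nonZero = nonZero′ ; eigenvector = eigenvector′ ; orthogonal = orthogonal′ }
    where
    root : charPoly 𝔽 M μ ≈ 0#
    root = ≈.trans (factors μ)
      (solve 3 (λ h μ p → h :* ((μ :- μ) :* p) := con (+ 0)) ≈.refl (h μ) μ (rootProduct μs μ))

    found = root⇒eigenvector M μ root
    v   = proj₁ found
    v≉0 = proj₁ (proj₂ found)
    Mv  = proj₂ (proj₂ found)
    inv = inverse (v ∙ v) (nonZero⇒∙≉0 v≉0)
    -- The strength for which the eigenvalue μ + σ (v ∙ v) of `v` becomes `s`.
    σ   = (s - μ) * proj₁ inv

    shift : μ + σ * v ∙ v ≈ s
    shift = begin
      μ + (s - μ) * proj₁ inv * v ∙ v     ≈⟨ solve 4 (λ μ s i w → μ :+ (s :- μ) :* i :* w := μ :+ (s :- μ) :* (w :* i)) ≈.refl μ s (proj₁ inv) (v ∙ v) ⟩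
      μ + (s - μ) * (v ∙ v * proj₁ inv)   ≈⟨ +-congˡ (*-congˡ (proj₂ inv)) ⟩
      μ + (s - μ) * 1#                    ≈⟨ solve 2 (λ μ s → μ :+ (s :- μ) :* con (+ 1) := s) ≈.refl μ s ⟩
      s                                   ∎

    M′ = deflate M σ v

    -- The cofactor collects one factor x - s for each root already moved. The determinant identity
    -- yields the factorisation only after cancelling x - μ, hence first for x different from μ;
    -- `polynomial-ext` fills the gap, with both sides weakened to a common degree bound.
    factors′ : ∀ x → charPoly 𝔽 M′ x ≈ ((1# * x + - s) * h x) * rootProduct μs x
    factors′ = polynomial-ext (weaken ((1 ℕ.+ d) ℕ.+ k) (charPoly-polynomial M′))
      (≡.subst (λ e → Polynomial e (λ x → ((1# * x + - s) * h x) * rootProduct μs x)) (ℕₚ.+-comm n _)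
        (weaken n (polynomial-product (polynomial-product (polynomial-linear 1# (- s)) h-poly) (rootProduct-polynomial μs))))
      μ λ x x-μ≉0 → x-y≈0⇒x≈y (cancel-nonzero x-μ≉0 (begin
        (x - μ) * (charPoly 𝔽 M′ x - ((1# * x + - s) * h x) * rootProduct μs x)
          ≈⟨ solve 6 (λ x μ c s h p → (x :- μ) :* (c :- ((con (+ 1) :* x :- s) :* h) :* p) :=
               (x :- μ) :* c :- (x :- s) :* (h :* ((x :- μ) :* p))) ≈.refl x μ (charPoly 𝔽 M′ x) s (h x) (rootProduct μs x) ⟩
        (x - μ) * charPoly 𝔽 M′ x - (x - s) * (h x * rootProduct (μ ∷ μs) x)
          ≈⟨ x≈y⇒x-y≈0 (≈.trans (charPoly-deflate M-sym Mv σ x) (*-cong (+-congˡ (-‿cong shift)) (factors x))) ⟩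
        0# ∎))

    remaining : OrthogonalEigenvectors M′ (lookup μs)
    remaining = deflation M′ (deflate-symmetric σ v M-sym)
      (polynomial-product (polynomial-linear 1# (- s)) h-poly) μs s (s≉ ∘ suc) factors′
    open OrthogonalEigenvectors remaining

    M′v : Eigenvector M′ s v
    M′v i = begin
      M′ i ∙ v                     ≈⟨ deflate-∙ M σ v i v ⟩
      M i ∙ v + σ * v i * v ∙ v    ≈⟨ +-congʳ (Mv i) ⟩
      μ * v i + σ * v i * v ∙ v    ≈⟨ solve 4 (λ μ x s w → μ :* x :+ s :* x :* w := (μ :+ s :* w) :* x) ≈.refl μ (v i) σ (v ∙ v) ⟩
      (μ + σ * v ∙ v) * v i        ≈⟨ *-congʳ shift ⟩
      s * v i                      ∎

    -- In the deflated matrix `v` belongs to `s`, which is none of the remaining roots;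
    -- orthogonality is thus automatic even if μ occurs again in the list.
    v∙vector : ∀ i → v ∙ vector i ≈ 0#
    v∙vector i = eigenvectors-orthogonal (deflate-symmetric σ v M-sym) M′v (eigenvector i) (s≉ (suc i))

    vector′ : Fin (suc k) → Fin n → Carrier
    vector′ zero    = v
    vector′ (suc i) = vector i

    nonZero′ : ∀ i → NonZero (vector′ i)
    nonZero′ zero    = v≉0
    nonZero′ (suc i) = nonZero i

    eigenvector′ : ∀ i → Eigenvector M (lookup (μ ∷ μs) i) (vector′ i)
    eigenvector′ zero      = Mv
    -- On vectors orthogonal to `v` the deflated matrix and `M` act alike.
    eigenvector′ (suc i) j = begin
      M j ∙ vector i                              ≈⟨ solve 2 (λ x y → x := x :+ y :* con (+ 0)) ≈.refl (M j ∙ vector i) (σ * v j) ⟩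
      M j ∙ vector i + σ * v j * 0#               ≈⟨ +-congˡ (*-congˡ (v∙vector i)) ⟨
      M j ∙ vector i + σ * v j * v ∙ vector i     ≈⟨ deflate-∙ M σ v j (vector i) ⟨
      M′ j ∙ vector i                             ≈⟨ eigenvector i j ⟩
      lookup μs i * vector i j                    ∎

    orthogonal′ : ∀ i j → i ≢ j → vector′ i ∙ vector′ j ≈ 0#
    orthogonal′ zero    zero    0≢0 = contradiction ≡.refl 0≢0
    orthogonal′ zero    (suc j) _   = v∙vector j
    orthogonal′ (suc i) zero    _   = ≈.trans (∙-comm (vector i) v) (v∙vector i)
    orthogonal′ (suc i) (suc j) i≢j = orthogonal i j (i≢j ∘ ≡.cong suc)

  upperBound : ∀ {k} (μs : Vec Carrier k) → ∃ λ s → ∀ i → lookup μs i ≤ s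
  upperBound []       = 0# , λ ()
  upperBound (μ ∷ μs) with upperBound μs
  ... | s , ≤s with total μ s
  ...   | inj₁ μ≤s = s , λ { zero → μ≤s ; (suc i) → ≤s i }
  ...   | inj₂ s≤μ = μ , λ { zero → ≤-refl ; (suc i) → ≤-trans (≤s i) s≤μ }

  -- The moved roots are parked at one more than an upper bound of the list, hence away from every
  -- entry; the initial cofactor is 1.
  spectral : ∀ {n} (M : Matrix 𝔽 n) → Symmetric M → (μs : Vec Carrier n) → IsSpectrum 𝔽 M μs →
    OrthogonalEigenvectors M (lookup μs)
  spectral M M-sym μs spectrum = deflation M M-sym {λ _ → 1#} (constant {0} 1# (λ _ → ≈.refl)) μs (s + 1#)
    (λ i s+1≈μᵢ → fromℕ-suc≰ 0 (≤-respʳ-≈ (-‿inverseʳ s)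
      (≤-respˡ-≈ (solve 1 (λ s → (s :+ con (+ 1)) :- s := con (+ 1) :+ con (+ 0)) ≈.refl s)
        (+-monoˡ-≤ (- s) (≤-respˡ-≈ (≈.sym s+1≈μᵢ) (proj₂ (upperBound μs) i))))))
    (λ x → ≈.trans (spectrum x) (≈.sym (*-identityˡ _)))
    where s = proj₁ (upperBound μs)

-- Counting the entries of a list that satisfy a predicate.

module Counting {a p} {A : Set a} {P : Pred A p} (P? : Decidable P) where

  count≥⇒injection : ∀ {n} (xs : Vec A n) k → k ℕ.≤ count P? xs →
    ∃ λ (f : Fin k → Fin n) → Injective _≡_ _≡_ f × (∀ i → P (lookup xs (f i)))
  count≥⇒injection xs       zero    k≤ = (λ ()) , (λ { {()} }) , λ ()
  count≥⇒injection (x ∷ xs) (suc k) k≤ with P? x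
  ... | no _   = let f , f-injective , Pf = count≥⇒injection xs (suc k) k≤ in
                 suc ∘ f , f-injective ∘ suc-injective , Pf
  ... | yes px = let f , f-injective , Pf = count≥⇒injection xs k (ℕₚ.≤-pred k≤) in
                 (λ { zero → zero ; (suc i) → suc (f i) }) ,
                 (λ { {zero} {zero} _ → ≡.refl ; {suc i} {suc j} eq → ≡.cong suc (f-injective (suc-injective eq)) }) ,
                 (λ { zero → px ; (suc i) → Pf i })

  count≤0⇒none : ∀ {n} (xs : Vec A n) → count P? xs ℕ.≤ 0 → ∀ i → ¬ P (lookup xs i)
  count≤0⇒none (x ∷ xs) ≤0 i with P? x
  count≤0⇒none (x ∷ xs) ()  i       | yes _
  count≤0⇒none (x ∷ xs) ≤0 zero     | no ¬px = ¬px
  count≤0⇒none (x ∷ xs) ≤0 (suc i)  | no _   = count≤0⇒none xs ≤0 i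

  count≤1⇒allButOne : ∀ {n} (xs : Vec A (suc n)) → count P? xs ℕ.≤ 1 → ∃ λ i → ∀ j → j ≢ i → ¬ P (lookup xs j)
  count≤1⇒allButOne (x ∷ xs) ≤1 with P? x
  count≤1⇒allButOne (x ∷ xs) ≤1 | yes _ = zero , λ
    { zero 0≢0 → contradiction ≡.refl 0≢0 ; (suc j) _ → count≤0⇒none xs (ℕₚ.≤-pred ≤1) j }
  -- No entry satisfies `P` here, so the exceptional index is an arbitrary choice.
  count≤1⇒allButOne (x ∷ [])     ≤1 | no _   = zero , λ { zero 0≢0 → contradiction ≡.refl 0≢0 }
  count≤1⇒allButOne (x ∷ y ∷ xs) ≤1 | no ¬px =
    let i , none = count≤1⇒allButOne (y ∷ xs) ≤1 in
    suc i , λ { zero _ → ¬px ; (suc j) j≢i → none j (j≢i ∘ ≡.cong suc) }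

-- Eigenvalue counts from the sign of a quadratic form.

module Inertia {c ℓ₁ ℓ₂} (𝔽 : OrderedField c ℓ₁ ℓ₂) where
  open OrderedFieldProperties 𝔽
  open ExteriorAlgebra 𝔽 using (Rows)
  open LinearSystems 𝔽
  open SymmetricMatrices 𝔽

  combination : ∀ {k n} → (Fin k → Carrier) → Rows k n → Fin n → Carrier
  combination a v j = sum λ i → a i * v i j

  -- The quadratic form of M - t. Its sign replaces the comparison of a Rayleigh quotient with `t`
  -- and involves no division.
  excess : ∀ {n} → Matrix 𝔽 n → Carrier → (Fin n → Carrier) → Carrier
  excess M t x = x ∙ (λ i → M i ∙ x) - t * x ∙ x

  excess-cong : ∀ {n} (M : Matrix 𝔽 n) t {x y : Fin n → Carrier} → (∀ i → x i ≈ y i) → excess M t x ≈ excess M t y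
  excess-cong M t x≈y = +-cong
    (∙-cong x≈y λ i → ∙-cong {w = M i} (λ _ → ≈.refl) x≈y) (-‿cong (*-congˡ (∙-cong x≈y x≈y)))

  module _ {n k} {M : Matrix 𝔽 n} {μs : Fin k → Carrier} (M-sym : Symmetric M) (E : OrthogonalEigenvectors M μs) where
    open OrthogonalEigenvectors E

    weight : (Fin k → Carrier) → Fin k → Carrier
    weight a i = a i * a i * vector i ∙ vector i

    weight-nonNegative : ∀ a i → 0# ≤ weight a i
    weight-nonNegative a i = *-nonNegative (square-nonNegative (a i)) (∙-positive (vector i))

    weight≈0 : ∀ a i → weight a i ≈ 0# → a i ≈ 0#
    weight≈0 a i eq = square≈0 (cancel-nonzero (nonZero⇒∙≉0 (nonZero i)) (≈.trans (*-comm _ _) eq))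

    combination-∙ : ∀ a i → combination a vector ∙ vector i ≈ a i * vector i ∙ vector i
    combination-∙ a i = begin
      combination a vector ∙ vector i        ≈⟨ ∙-comm (combination a vector) (vector i) ⟩
      vector i ∙ combination a vector        ≈⟨ ∙-sumʳ (vector i) a vector ⟩
      (sum λ j → a j * vector i ∙ vector j)
        ≈⟨ sum-single (λ j → a j * vector i ∙ vector j) i (λ j j≢i → ≈.trans (*-congˡ (orthogonal i j (j≢i ∘ ≡.sym))) (zeroʳ (a j))) ⟩
      a i * vector i ∙ vector i              ∎

    combination-form : ∀ a x → x ∙ combination a vector ≈ sum λ i → a i * vector i ∙ x
    combination-form a x = ≈.trans (∙-sumʳ x a vector) (sum-cong-≋ λ i → *-congˡ (∙-comm x (vector i)))

    -- Orthogonality removes all mixed terms, so the form is diagonal in the coefficients; `weight`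
    -- is the squared length of one component.
    excess-combination : ∀ a t → excess M t (combination a vector) ≈ sum λ i → (μs i - t) * weight a i
    excess-combination a t = begin
      w ∙ Mw - t * w ∙ w
        ≈⟨ +-cong (≈.trans (∙-comm w Mw) (combination-form a Mw)) (-‿cong (*-congˡ (combination-form a w))) ⟩
      sum f - t * sum g
        ≈⟨ solve 3 (λ x t y → x :- t :* y := x :+ (:- t) :* y) ≈.refl (sum f) t (sum g) ⟩
      sum f + - t * sum g                       ≈⟨ +-congˡ (*-distribˡ-sum (- t) g) ⟩
      sum f + sum (λ i → - t * g i)             ≈⟨ ∑-distrib-+ f (λ i → - t * g i) ⟨
      sum (λ i → f i + - t * g i)               ≈⟨ sum-cong-≋ term ⟩
      (sum λ i → (μs i - t) * weight a i)       ∎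
      where
      w  = combination a vector
      Mw : Fin n → Carrier
      Mw j = M j ∙ w
      f g : Fin k → Carrier
      f i = a i * vector i ∙ Mw
      g i = a i * vector i ∙ w

      v∙w : ∀ i → vector i ∙ w ≈ a i * vector i ∙ vector i
      v∙w i = ≈.trans (∙-comm (vector i) w) (combination-∙ a i)

      v∙Mw : ∀ i → vector i ∙ Mw ≈ μs i * (a i * vector i ∙ vector i)
      v∙Mw i = begin
        vector i ∙ Mw                        ≈⟨ self-adjoint M-sym (vector i) w ⟩
        w ∙ (λ j → M j ∙ vector i)           ≈⟨ eigenvector-form {M = M} (eigenvector i) w ⟩
        μs i * w ∙ vector i                  ≈⟨ *-congˡ (combination-∙ a i) ⟩
        μs i * (a i * vector i ∙ vector i)   ∎

      term : ∀ i → f i + - t * g i ≈ (μs i - t) * weight a i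
      term i = ≈.trans (+-cong (*-congˡ (v∙Mw i)) (*-congˡ (*-congˡ (v∙w i))))
        (solve 4 (λ a μ t v → a :* (μ :* (a :* v)) :+ (:- t) :* (a :* (a :* v)) := (μ :- t) :* (a :* a :* v))
          ≈.refl (a i) (μs i) t (vector i ∙ vector i))

  -- More eigenvectors below t than constraints: some nonzero combination satisfies all constraints.
  fewEigenvaluesBelow : ∀ {n k} {M : Matrix 𝔽 n} {μs : Fin (suc k) → Carrier} → Symmetric M →
    OrthogonalEigenvectors M μs → ∀ t (l : Rows k n) →
    (∀ x → (∀ i → l i ∙ x ≈ 0#) → 0# ≤ excess M t x) → ¬ (∀ i → μs i < t)
  fewEigenvaluesBelow {n} {k} {M} {μs} M-sym E t l nonNegative below = proj₂ a≉0 (a≈0 (proj₁ a≉0))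
    where
    open OrthogonalEigenvectors E
    solution = underdetermined (λ i j → l i ∙ vector j)
    a   = proj₁ solution
    a≉0 = proj₁ (proj₂ solution)

    constraint : ∀ i → l i ∙ combination a vector ≈ 0#
    constraint i = ≈.trans (∙-sumʳ (l i) a vector)
      (≈.trans (sum-cong-≋ λ j → *-comm (a j) (l i ∙ vector j)) (proj₂ (proj₂ solution) i))

    gap : Fin (suc k) → Carrier
    gap i = (t - μs i) * weight M-sym E a i

    sum-gap≤0 : sum gap ≤ 0#
    sum-gap≤0 = 0≤y-x⇒x≤y (≤-respʳ-≈ (begin
      excess M t (combination a vector)                        ≈⟨ excess-combination M-sym E a t ⟩
      (sum λ i → (μs i - t) * weight M-sym E a i)
        ≈⟨ sum-cong-≋ (λ i → solve 3 (λ μ t w → (μ :- t) :* w := con -[1+ 0 ] :* ((t :- μ) :* w)) ≈.refl (μs i) t (weight M-sym E a i)) ⟩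
      (sum λ i → - 1# * gap i)                                 ≈⟨ *-distribˡ-sum (- 1#) gap ⟨
      - 1# * sum gap                                           ≈⟨ solve 1 (λ x → con -[1+ 0 ] :* x := con (+ 0) :- x) ≈.refl (sum gap) ⟩
      0# - sum gap                                             ∎)
      (nonNegative (combination a vector) constraint))

    -- All terms of `sum gap` are non-negative and their sum is at most zero, so each vanishes. As t
    -- - μᵢ is non-zero, the weight does, and with it the coefficient.
    a≈0 : ∀ i → a i ≈ 0#
    a≈0 i = weight≈0 M-sym E a i (cancel-nonzero
      (λ t-μᵢ≈0 → proj₂ (below i) (≈.sym (x-y≈0⇒x≈y t-μᵢ≈0)))
      (nonNegative-sum≈0 (λ j → *-nonNegative (x≤y⇒0≤y-x (proj₁ (below j))) (weight-nonNegative M-sym E a j)) sum-gap≤0 i))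

  -- The bound by -(α² + β²) expresses negative definiteness and the independence of `b₀` and `b₁`
  -- at once: where the combination is zero, it forces α = β = 0.
  NegativePlane : ∀ {n} → Matrix 𝔽 n → Carrier → Set (c ⊔ ℓ₂)
  NegativePlane {n} M t = ∃₂ λ (b₀ b₁ : Fin n → Carrier) →
    ∀ α β → excess M t (λ j → α * b₀ j + β * b₁ j) ≤ - (α * α + β * β)

  -- The eigenvectors other than vector p span a space of dimension n - 1, which meets the plane.
  twoEigenvaluesBelow : ∀ {n} {M : Matrix 𝔽 n} {μs : Fin n → Carrier} → Symmetric M →
    OrthogonalEigenvectors M μs → ∀ t → NegativePlane M t → ∀ p → ¬ (∀ i → i ≢ p → t ≤ μs i)
  twoEigenvaluesBelow {n} {M} {μs} M-sym E t (b₀ , b₁ , negative) p above = proj₂ z≉0 (z≈0 (proj₁ z≉0))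
    where
    open OrthogonalEigenvectors E

    -- There are n + 2 unknowns α, β, a and n + 1 equations: a p = 0, and α b₀ + β b₁ = ∑ aᵢ vᵢ in
    -- each coordinate.
    system : Rows (suc n) (suc (suc n))
    system zero    zero          = 0#
    system zero    (suc zero)    = 0#
    system zero    (suc (suc i)) = δ p i
    system (suc j) zero          = b₀ j
    system (suc j) (suc zero)    = b₁ j
    system (suc j) (suc (suc i)) = - vector i j

    solution = underdetermined system
    z   = proj₁ solution
    z≉0 = proj₁ (proj₂ solution)
    α   = z zero
    β   = z (suc zero)
    a : Fin n → Carrier
    a i = z (suc (suc i))
    w = combination a vector

    aₚ≈0 : a p ≈ 0#
    aₚ≈0 = begin
      a p                               ≈⟨ δ-∙ p a ⟨
      δ p ∙ a                           ≈⟨ solve 3 (λ x y s → s := con (+ 0) :* x :+ (con (+ 0) :* y :+ s)) ≈.refl α β (δ p ∙ a) ⟩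
      0# * α + (0# * β + δ p ∙ a)       ≈⟨ proj₂ (proj₂ solution) zero ⟩
      0#                                ∎

    w≈ : ∀ j → w j ≈ α * b₀ j + β * b₁ j
    w≈ j = begin
      w j                                      ≈⟨ solve 3 (λ x y s → s := (x :+ y) :- (x :+ (y :- s))) ≈.refl (b₀ j * α) (b₁ j * β) (w j) ⟩
      (b₀ j * α + b₁ j * β) - (b₀ j * α + (b₁ j * β - w j))
        ≈⟨ +-cong (+-cong (*-comm (b₀ j) α) (*-comm (b₁ j) β)) (-‿cong (≈.trans (+-congˡ (+-congˡ negated)) (proj₂ (proj₂ solution) (suc j)))) ⟩
      (α * b₀ j + β * b₁ j) - 0#               ≈⟨ solve 1 (λ x → x :- con (+ 0) := x) ≈.refl (α * b₀ j + β * b₁ j) ⟩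
      α * b₀ j + β * b₁ j                      ∎
      where
      negated : - w j ≈ sum λ i → - vector i j * a i
      negated = begin
        - w j                                  ≈⟨ solve 1 (λ x → :- x := con -[1+ 0 ] :* x) ≈.refl (w j) ⟩
        - 1# * w j                             ≈⟨ *-distribˡ-sum (- 1#) (λ i → a i * vector i j) ⟩
        (sum λ i → - 1# * (a i * vector i j))  ≈⟨ sum-cong-≋ (λ i → solve 2 (λ a v → con -[1+ 0 ] :* (a :* v) := (:- v) :* a) ≈.refl (a i) (vector i j)) ⟩
        (sum λ i → - vector i j * a i)         ∎

    term-nonNegative : ∀ i → 0# ≤ (μs i - t) * weight M-sym E a i
    term-nonNegative i with i ≟ p
    ... | no i≢p     = *-nonNegative (x≤y⇒0≤y-x (above i i≢p)) (weight-nonNegative M-sym E a i)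
    ... | yes ≡.refl = ≤-reflexive (≈.sym (begin
      (μs p - t) * (a p * a p * vector p ∙ vector p)   ≈⟨ *-congˡ (*-congʳ (*-congˡ aₚ≈0)) ⟩
      (μs p - t) * (a p * 0# * vector p ∙ vector p)
        ≈⟨ solve 3 (λ x y z → x :* (y :* con (+ 0) :* z) := con (+ 0)) ≈.refl (μs p - t) (a p) (vector p ∙ vector p) ⟩
      0#                                               ∎))

    excess-nonNegative : 0# ≤ excess M t (λ j → α * b₀ j + β * b₁ j)
    excess-nonNegative = ≤-respʳ-≈ (≈.trans (≈.sym (excess-combination M-sym E a t)) (excess-cong M t w≈))
      (sum-nonNegative term-nonNegative)

    squares≤0 : α * α + β * β ≤ 0#
    squares≤0 = 0≤y-x⇒x≤y (≤-respʳ-≈ (≈.sym (+-identityˡ _)) (≤-trans excess-nonNegative (negative α β)))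

    α≈0 : α ≈ 0#
    α≈0 = square≈0 (nonNegative-sum≈0ˡ (square-nonNegative α) (square-nonNegative β) squares≤0)

    β≈0 : β ≈ 0#
    β≈0 = square≈0 (nonNegative-sum≈0ʳ (square-nonNegative α) (square-nonNegative β) squares≤0)

    w≈0 : ∀ j → w j ≈ 0#
    w≈0 j = ≈.trans (w≈ j) (≈.trans (+-cong (*-congʳ α≈0) (*-congʳ β≈0))
      (solve 2 (λ x y → con (+ 0) :* x :+ con (+ 0) :* y := con (+ 0)) ≈.refl (b₀ j) (b₁ j)))

    -- The common vector `w` is zero, and its products with the orthogonal family recover the
    -- coefficients `a`. So the whole solution would vanish.
    z≈0 : ∀ i → z i ≈ 0#
    z≈0 zero          = α≈0
    z≈0 (suc zero)    = β≈0
    z≈0 (suc (suc i)) = cancel-nonzero (nonZero⇒∙≉0 (nonZero i)) (begin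
      vector i ∙ vector i * a i     ≈⟨ *-comm (vector i ∙ vector i) (a i) ⟩
      a i * vector i ∙ vector i     ≈⟨ combination-∙ M-sym E a i ⟨
      w ∙ vector i                  ≈⟨ sum-zero (λ j → ≈.trans (*-congʳ (w≈0 j)) (zeroˡ (vector i j))) ⟩
      0#                            ∎)

  restrict : ∀ {n k l} {M : Matrix 𝔽 n} {μs : Fin k → Carrier} (f : Fin l → Fin k) → Injective _≡_ _≡_ f →
    OrthogonalEigenvectors M μs → OrthogonalEigenvectors M (μs ∘ f)
  restrict f f-injective E = record
    { vector = vector ∘ f ; nonZero = nonZero ∘ f ; eigenvector = eigenvector ∘ f
    ; orthogonal = λ i j i≢j → orthogonal (f i) (f j) (i≢j ∘ f-injective) }
    where open OrthogonalEigenvectors E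

  -- This settles the left end of the interval: an eigenvalue outside [0, t) must then be at least
  -- `t`.
  eigenvalue-nonNegative : ∀ {n} {M : Matrix 𝔽 n} {μ v} → (∀ x → 0# ≤ x ∙ (λ i → M i ∙ x)) →
    NonZero v → Eigenvector M μ v → 0# ≤ μ
  eigenvalue-nonNegative {M = M} {μ} {v} psd v≉0 Mv with total 0# μ
  ... | inj₁ 0≤μ = 0≤μ
  ... | inj₂ μ≤0 = ≤-reflexive (≈.sym (cancel-nonzero (nonZero⇒∙≉0 v≉0) (antisym
          (≤-respʳ-≈ (zeroʳ (v ∙ v)) (*-monoˡ-≤ (v ∙ v) (∙-positive v) μ≤0))
          (≤-respʳ-≈ (≈.trans (eigenvector-form {M = M} Mv v) (*-comm μ (v ∙ v))) (psd v)))))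

-- The quadratic form of the signless Laplacian and degree counts.

-- In the complement, each vertex other than the centres `u` and `v` has at most one neighbour, and
-- that neighbour is a centre. The condition is phrased through adjacency in `G`, which gives the
-- rows of the adjacency matrix directly and passes through isomorphisms.
DoubleStarComplement : {V : Set} → Graph V → V → V → Set
DoubleStarComplement G u v =
  ∀ i → i ≢ u → i ≢ v → ∃ λ w → (w ≡ u ⊎ w ≡ v) × (∀ j → j ≢ i → j ≢ w → adj G i j ≡ true)

module SignlessLaplacian {c ℓ₁ ℓ₂} (𝔽 : OrderedField c ℓ₁ ℓ₂) {n} (G : Graph (Fin n)) where
  open OrderedFieldProperties 𝔽
  open SymmetricMatrices 𝔽
  open Inertia 𝔽

  A Q : Matrix 𝔽 n
  A = adjacencyMatrix 𝔽 G
  Q = signlessLaplacian 𝔽 G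

  deg : Fin n → Carrier
  deg i = fromℕ (degree G i)

  A-edge : ∀ {i j} → adj G i j ≡ true → A i j ≈ 1#
  A-edge eq rewrite eq = ≈.refl

  A-nonEdge : ∀ {i j} → adj G i j ≡ false → A i j ≈ 0#
  A-nonEdge eq rewrite eq = ≈.refl

  A-nonNegative : ∀ i j → 0# ≤ A i j
  A-nonNegative i j with adj G i j
  ... | true  = 0≤1
  ... | false = ≤-refl

  A-symmetric : Symmetric A
  A-symmetric i j rewrite adj-sym G i j = ≈.refl

  Q-symmetric : Symmetric Q
  Q-symmetric i j = +-cong (diagonal-symmetric deg i j) (A-symmetric i j)

  fromℕ-∣tabulate∣ : ∀ {k} (b : Fin k → Bool) → fromℕ ∣ tabulate b ∣ ≈ sum λ i → if b i then 1# else 0#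
  fromℕ-∣tabulate∣ {zero}  b = ≈.refl
  fromℕ-∣tabulate∣ {suc k} b with b zero
  ... | true  = +-congˡ (fromℕ-∣tabulate∣ (b ∘ suc))
  ... | false = ≈.trans (fromℕ-∣tabulate∣ (b ∘ suc)) (≈.sym (+-identityˡ _))

  deg≈sum : ∀ i → deg i ≈ sum (A i)
  deg≈sum i = fromℕ-∣tabulate∣ (adj G i)

  Q-∙ : ∀ i x → Q i ∙ x ≈ deg i * x i + A i ∙ x
  Q-∙ i x = begin
    Q i ∙ x                                           ≈⟨ ∙-comm (Q i) x ⟩
    x ∙ Q i                                           ≈⟨ ∙-+ʳ x (diagonal 𝔽 deg i) (A i) ⟩
    x ∙ diagonal 𝔽 deg i + x ∙ A i                    ≈⟨ +-cong (∙-comm x (diagonal 𝔽 deg i)) (∙-comm x (A i)) ⟩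
    diagonal 𝔽 deg i ∙ x + A i ∙ x                    ≈⟨ +-congʳ (diagonal-∙ deg i x) ⟩
    deg i * x i + A i ∙ x                             ∎

  Q-edge : ∀ {i j} → i ≢ j → adj G i j ≡ true → Q i j ≈ 1#
  Q-edge {i} {j} i≢j eq = ≈.trans (+-cong (≈.trans (diagonal-δ deg i j) (*-congˡ (δ-offDiagonal i≢j))) (A-edge eq))
    (≈.trans (+-congʳ (zeroʳ (deg i))) (+-identityˡ 1#))

  Q-nonEdge : ∀ {i j} → i ≢ j → adj G i j ≡ false → Q i j ≈ 0#
  Q-nonEdge {i} {j} i≢j eq = ≈.trans (+-cong (≈.trans (diagonal-δ deg i j) (*-congˡ (δ-offDiagonal i≢j))) (A-nonEdge eq))
    (≈.trans (+-congʳ (zeroʳ (deg i))) (+-identityˡ 0#))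

  Q-diagonal : ∀ i → Q i i ≈ deg i
  Q-diagonal i = ≈.trans (+-cong (≈.trans (diagonal-δ deg i i) (*-congˡ (δ-diagonal i))) (A-nonEdge (adj-irrefl G i)))
    (≈.trans (+-identityʳ _) (*-identityʳ (deg i)))

  -- Twice the form of Q is the sum of A i j (xᵢ + xⱼ)² over all ordered pairs.
  Q-nonNegative : ∀ x → 0# ≤ x ∙ (λ i → Q i ∙ x)
  Q-nonNegative x = half-nonNegative (≤-respʳ-≈ (≈.sym doubled)
    (sum-nonNegative λ i → sum-nonNegative λ j → *-nonNegative (A-nonNegative i j) (square-nonNegative (x i + x j))))
    where
    half-nonNegative : ∀ {y} → 0# ≤ y + y → 0# ≤ y
    half-nonNegative {y} 0≤2y with total 0# y
    ... | inj₁ 0≤y = 0≤y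
    ... | inj₂ y≤0 = ≤-trans 0≤2y (≤-respʳ-≈ (+-identityʳ y) (+-mono-≤ (≤-refl {y}) y≤0))

    D = sum λ i → sum λ j → A i j * (x i * x i)
    C = sum λ i → sum λ j → A i j * (x i * x j)

    form : x ∙ (λ i → Q i ∙ x) ≈ D + C
    form = ≈.trans (sum-cong-≋ λ i → begin
      x i * Q i ∙ x                                   ≈⟨ *-congˡ (Q-∙ i x) ⟩
      x i * (deg i * x i + A i ∙ x)                   ≈⟨ *-congˡ (+-congʳ (*-congʳ (deg≈sum i))) ⟩
      x i * (sum (A i) * x i + A i ∙ x)
        ≈⟨ solve 3 (λ x s a → x :* (s :* x :+ a) := s :* (x :* x) :+ x :* a) ≈.refl (x i) (sum (A i)) (A i ∙ x) ⟩
      sum (A i) * (x i * x i) + x i * A i ∙ x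
        ≈⟨ +-cong (*-distribʳ-sum (x i * x i) (A i)) (*-distribˡ-sum (x i) (λ j → A i j * x j)) ⟩
      (sum λ j → A i j * (x i * x i)) + (sum λ j → x i * (A i j * x j))
        ≈⟨ +-congˡ (sum-cong-≋ λ j → solve 3 (λ x a y → x :* (a :* y) := a :* (x :* y)) ≈.refl (x i) (A i j) (x j)) ⟩
      (sum λ j → A i j * (x i * x i)) + (sum λ j → A i j * (x i * x j)) ∎)
      (∑-distrib-+ (λ i → sum λ j → A i j * (x i * x i)) (λ i → sum λ j → A i j * (x i * x j)))

    D≈ : D ≈ sum λ i → sum λ j → A i j * (x j * x j)
    D≈ = ≈.trans (∑-comm λ i j → A i j * (x i * x i))
      (sum-cong-≋ λ j → sum-cong-≋ λ i → *-congʳ (A-symmetric i j))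

    sum₂-+ : ∀ (f g : Fin n → Fin n → Carrier) →
      (sum λ i → sum (f i)) + (sum λ i → sum (g i)) ≈ sum λ i → sum λ j → f i j + g i j
    sum₂-+ f g = ≈.trans (≈.sym (∑-distrib-+ (λ i → sum (f i)) (λ i → sum (g i))))
      (sum-cong-≋ λ i → ≈.sym (∑-distrib-+ (f i) (g i)))

    doubled : x ∙ (λ i → Q i ∙ x) + x ∙ (λ i → Q i ∙ x) ≈ sum λ i → sum λ j → A i j * ((x i + x j) * (x i + x j))
    doubled = begin
      x ∙ (λ i → Q i ∙ x) + x ∙ (λ i → Q i ∙ x)     ≈⟨ +-cong form (≈.trans form (+-congʳ D≈)) ⟩
      (D + C) + (D′ + C)                            ≈⟨ +-cong (sum₂-+ (λ i j → A i j * (x i * x i)) (λ i j → A i j * (x i * x j)))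
                                                         (sum₂-+ (λ i j → A i j * (x j * x j)) (λ i j → A i j * (x i * x j))) ⟩
      _ + _                                         ≈⟨ sum₂-+ (λ i j → A i j * (x i * x i) + A i j * (x i * x j))
                                                              (λ i j → A i j * (x j * x j) + A i j * (x i * x j)) ⟩
      _                                             ≈⟨ sum-cong-≋ (λ i → sum-cong-≋ λ j → solve 3 (λ a x y →
        (a :* (x :* x) :+ a :* (x :* y)) :+ (a :* (y :* y) :+ a :* (x :* y)) := a :* ((x :+ y) :* (x :+ y))) ≈.refl (A i j) (x i) (x j)) ⟩
      (sum λ i → sum λ j → A i j * ((x i + x j) * (x i + x j))) ∎
      where D′ = sum λ i → sum λ j → A i j * (x j * x j)

  sum-δ₂ : ∀ (f : Fin n → Carrier) u v → (sum λ j → f j + (δ u j + δ v j)) ≈ sum f + (1# + 1#)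
  sum-δ₂ f u v = ≈.trans (∑-distrib-+ f (λ j → δ u j + δ v j))
    (+-congˡ (≈.trans (∑-distrib-+ (δ u) (δ v)) (+-cong (sum-δ u) (sum-δ v))))

  δ-case : ∀ (i j : Fin n) → (i ≡ j × δ i j ≈ 1#) ⊎ (i ≢ j × δ i j ≈ 0#)
  δ-case i j with i ≟ j
  ... | yes i≡j = inj₁ (i≡j , ≈.refl)
  ... | no i≢j  = inj₂ (i≢j , ≈.refl)

  A≤1 : ∀ i j → A i j ≤ 1#
  A≤1 i j with adj G i j
  ... | true  = ≤-refl
  ... | false = 0≤1

  private
    δδ≤1 : ∀ u v j → u ≢ v → δ u j + δ v j ≤ 1#
    δδ≤1 u v j u≢v with δ-case u j | δ-case v j
    ... | inj₁ (u≡j , _)  | inj₁ (v≡j , _)  = contradiction (≡.trans u≡j (≡.sym v≡j)) u≢v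
    ... | inj₁ (_ , δu≈1) | inj₂ (_ , δv≈0) = ≤-reflexive (≈.trans (+-cong δu≈1 δv≈0) (+-identityʳ 1#))
    ... | inj₂ (_ , δu≈0) | inj₁ (_ , δv≈1) = ≤-reflexive (≈.trans (+-cong δu≈0 δv≈1) (+-identityˡ 1#))
    ... | inj₂ (_ , δu≈0) | inj₂ (_ , δv≈0) = ≤-respˡ-≈ (≈.sym (≈.trans (+-cong δu≈0 δv≈0) (+-identityˡ 0#))) 0≤1

  -- The neighbourhood of `u` and the k distinct points `f i` are disjoint, so their indicators add
  -- up to at most 1 at each vertex.
  degree+nonNeighbours≤ : ∀ {k} u (f : Fin k → Fin n) → Injective _≡_ _≡_ f → (∀ i → adj G u (f i) ≡ false) →
    degree G u ℕ.+ k ℕ.≤ n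
  degree+nonNeighbours≤ {k} u f f-injective non = fromℕ-cancel-≤ (≤-respˡ-≈ (begin
    (sum λ j → A u j + sum λ i → δ (f i) j)          ≈⟨ ∑-distrib-+ (A u) (λ j → sum λ i → δ (f i) j) ⟩
    sum (A u) + (sum λ j → sum λ i → δ (f i) j)      ≈⟨ +-cong (≈.sym (deg≈sum u)) (∑-comm (λ j i → δ (f i) j)) ⟩
    deg u + (sum λ i → sum λ j → δ (f i) j)          ≈⟨ +-congˡ (sum-cong-≋ (λ i → sum-δ (f i))) ⟩
    deg u + (sum {k} λ i → 1#)                       ≈⟨ +-congˡ (sum-replicate k) ⟩
    deg u + fromℕ k                                  ≈⟨ fromℕ-+ (degree G u) k ⟨
    fromℕ (degree G u ℕ.+ k)                         ∎)
    (≤-respʳ-≈ (sum-replicate n) (sum-mono-≤ pointwise)))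
    where
    pointwise : ∀ j → (A u j + sum λ i → δ (f i) j) ≤ 1#
    pointwise j with any? (λ i → f i ≟ j)
    ... | yes (i , fi≡j) = ≤-reflexive (≈.trans
      (+-cong (A-nonEdge (≡.subst (λ j → adj G u j ≡ false) fi≡j (non i)))
        (≈.trans (sum-single (λ i → δ (f i) j) i (λ i′ i′≢i → δ-offDiagonal (λ fi′≡j → i′≢i (f-injective (≡.trans fi′≡j (≡.sym fi≡j))))))
          (≈.trans (≈.reflexive (≡.cong (λ l → δ l j) fi≡j)) (δ-diagonal j))))
      (+-identityˡ 1#))
    ... | no  fi≢j       = ≤-respˡ-≈ (≈.sym (≈.trans
      (+-congˡ (sum-zero (λ i → δ-offDiagonal (λ fi≡j → fi≢j (i , fi≡j))))) (+-identityʳ (A u j)))) (A≤1 u j)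

  -- The two neighbourhoods and the pair {u, v} are pairwise disjoint.
  degrees+2≤ : ∀ u v → u ≢ v → adj G u v ≡ false → (∀ j → adj G u j ≡ true → adj G v j ≡ false) →
    (degree G u ℕ.+ degree G v) ℕ.+ 2 ℕ.≤ n
  degrees+2≤ u v u≢v u≁v noCommon = fromℕ-cancel-≤ (≤-respˡ-≈ (begin
    (sum λ j → (A u j + A v j) + (δ u j + δ v j))     ≈⟨ sum-δ₂ (λ j → A u j + A v j) u v ⟩
    (sum λ j → A u j + A v j) + (1# + 1#)             ≈⟨ +-congʳ (∑-distrib-+ (A u) (A v)) ⟩
    (sum (A u) + sum (A v)) + (1# + 1#)               ≈⟨ +-congʳ (+-cong (deg≈sum u) (deg≈sum v)) ⟨
    (deg u + deg v) + (1# + 1#)                       ≈⟨ +-cong (fromℕ-+ (degree G u) (degree G v)) (+-congˡ (+-identityʳ 1#)) ⟨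
    fromℕ (degree G u ℕ.+ degree G v) + fromℕ 2       ≈⟨ fromℕ-+ (degree G u ℕ.+ degree G v) 2 ⟨
    fromℕ ((degree G u ℕ.+ degree G v) ℕ.+ 2)         ∎)
    (≤-respʳ-≈ (sum-replicate n) (sum-mono-≤ pointwise)))
    where
    isolated : ∀ j → A u j ≈ 0# → A v j ≈ 0# → (A u j + A v j) + (δ u j + δ v j) ≤ 1#
    isolated j u≁j v≁j = ≤-respˡ-≈ (≈.sym (≈.trans (+-congʳ (≈.trans (+-cong u≁j v≁j) (+-identityˡ 0#))) (+-identityˡ _)))
      (δδ≤1 u v j u≢v)

    pointwise : ∀ j → (A u j + A v j) + (δ u j + δ v j) ≤ 1#
    pointwise j with δ-case u j | δ-case v j
    ... | inj₁ (≡.refl , _) | _ = isolated j (A-nonEdge (adj-irrefl G u)) (A-nonEdge (≡.trans (adj-sym G v u) u≁v))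
    ... | inj₂ _ | inj₁ (≡.refl , _) = isolated j (A-nonEdge u≁v) (A-nonEdge (adj-irrefl G v))
    ... | inj₂ (_ , δu≈0) | inj₂ (_ , δv≈0) = ≤-respˡ-≈
      (≈.sym (≈.trans (+-congˡ (≈.trans (+-cong δu≈0 δv≈0) (+-identityˡ 0#))) (+-identityʳ _))) AA≤1
      where
      AA≤1 : A u j + A v j ≤ 1#
      AA≤1 with adj G u j in uj
      ... | false = ≤-respˡ-≈ (≈.sym (+-identityˡ (A v j))) (A≤1 v j)
      ... | true  = ≤-reflexive (≈.trans (+-congˡ (A-nonEdge (noCommon j uj))) (+-identityʳ 1#))

  -- The neighbourhood of `u` together with `u` and `w` covers all vertices.
  ≤degree+2 : ∀ u w → (∀ j → j ≢ u → j ≢ w → adj G u j ≡ true) → fromℕ n ≤ deg u + (1# + 1#)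
  ≤degree+2 u w rest = ≤-respˡ-≈ (sum-replicate n) (≤-respʳ-≈
    (≈.trans (sum-δ₂ (A u) u w) (+-congʳ (≈.sym (deg≈sum u)))) (sum-mono-≤ pointwise))
    where
    0≤δ : ∀ v j → 0# ≤ δ v j
    0≤δ v j with δ-case v j
    ... | inj₁ (_ , δ≈1) = ≤-respʳ-≈ (≈.sym δ≈1) 0≤1
    ... | inj₂ (_ , δ≈0) = ≤-reflexive (≈.sym δ≈0)

    1≤+ : ∀ {x y} → 1# ≤ x → 0# ≤ y → 1# ≤ x + y
    1≤+ 1≤x 0≤y = ≤-respˡ-≈ (+-identityʳ 1#) (+-mono-≤ 1≤x 0≤y)

    1≤+′ : ∀ {x y} → 0# ≤ x → 1# ≤ y → 1# ≤ x + y
    1≤+′ 0≤x 1≤y = ≤-respˡ-≈ (+-identityˡ 1#) (+-mono-≤ 0≤x 1≤y)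

    pointwise : ∀ j → 1# ≤ A u j + (δ u j + δ w j)
    pointwise j with δ-case u j | δ-case w j
    ... | inj₁ (_ , δu≈1)  | _                = 1≤+′ (A-nonNegative u j) (1≤+ (≤-reflexive (≈.sym δu≈1)) (0≤δ w j))
    ... | inj₂ _           | inj₁ (_ , δw≈1)  = 1≤+′ (A-nonNegative u j) (1≤+′ (0≤δ u j) (≤-reflexive (≈.sym δw≈1)))
    ... | inj₂ (u≢j , _)   | inj₂ (w≢j , _)   = 1≤+ (≤-reflexive (≈.sym (A-edge (rest j (u≢j ∘ ≡.sym) (w≢j ∘ ≡.sym)))))
                                                  (+-nonNegative (0≤δ u j) (0≤δ w j))

  -- Vertices other than u and v have degree at least n - 2 and are mutually adjacent, so on
  -- vectors vanishing at u and v the form of Q - t, t = n - 3, is at least (∑ xᵢ)².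
  excess-doubleStar : ∀ {u v t} → fromℕ n ≈ t + (1# + 1# + 1#) →
    DoubleStarComplement G u v → ∀ x → x u ≈ 0# → x v ≈ 0# → 0# ≤ excess Q t x
  excess-doubleStar {u} {v} {t} n≈ doubleStar x xu≈0 xv≈0 = x≤y⇒0≤y-x (≤-trans
    (≤-respʳ-≈ (+-comm (s * s) (t * x ∙ x)) (≤-respˡ-≈ (+-identityˡ (t * x ∙ x)) (+-monoˡ-≤ (t * x ∙ x) (square-nonNegative s))))
    (≤-respˡ-≈ total-bound (sum-mono-≤ bound)))
    where
    s = sum x

    total-bound : (sum λ i → t * (x i * x i) + x i * s) ≈ t * x ∙ x + s * s
    total-bound = ≈.trans (∑-distrib-+ (λ i → t * (x i * x i)) (λ i → x i * s))
      (+-cong (≈.sym (*-distribˡ-sum t (λ i → x i * x i))) (≈.sym (*-distribʳ-sum s x)))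

    vanishing : ∀ i → x i ≈ 0# → t * (x i * x i) + x i * s ≤ x i * Q i ∙ x
    vanishing i xi≈0 = ≤-reflexive (≈.trans
      (+-cong (*-congˡ (*-congʳ xi≈0)) (*-congʳ xi≈0))
      (≈.trans (solve 4 (λ t x s q → t :* (con (+ 0) :* x) :+ con (+ 0) :* s := con (+ 0) :* q) ≈.refl t (x i) s (Q i ∙ x))
        (*-congʳ (≈.sym xi≈0))))

    vanishes : ∀ w → w ≡ u ⊎ w ≡ v → x w ≈ 0#
    vanishes w (inj₁ ≡.refl) = xu≈0
    vanishes w (inj₂ ≡.refl) = xv≈0

    -- The estimate holds row by row. Away from the centres the difference of the two sides is (deg
    -- i + 2 - n) xᵢ², with deg i ≥ n - 2; at a centre both sides vanish.
    bound : ∀ i → t * (x i * x i) + x i * s ≤ x i * Q i ∙ x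
    bound i with i ≟ u | i ≟ v
    ... | yes ≡.refl | _          = vanishing i xu≈0
    ... | no _       | yes ≡.refl = vanishing i xv≈0
    ... | no i≢u     | no i≢v     = bound′ (doubleStar i i≢u i≢v)
      where
      bound′ : (∃ λ w → (w ≡ u ⊎ w ≡ v) × (∀ j → j ≢ i → j ≢ w → adj G i j ≡ true)) →
        t * (x i * x i) + x i * s ≤ x i * Q i ∙ x
      bound′ (w , w∈ , rest) = 0≤y-x⇒x≤y (≤-respʳ-≈ (begin
        (deg i + (1# + 1#) - fromℕ n) * (x i * x i)          ≈⟨ *-congʳ (+-congˡ (-‿cong n≈)) ⟩
        (deg i + (1# + 1#) - (t + (1# + 1# + 1#))) * (x i * x i)
          ≈⟨ solve 4 (λ d t x s → (d :+ con (+ 2) :- (t :+ con (+ 3))) :* (x :* x) :=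
               x :* (d :* x :+ (s :- x)) :- (t :* (x :* x) :+ x :* s)) ≈.refl (deg i) t (x i) s ⟩
        x i * (deg i * x i + (s - x i)) - (t * (x i * x i) + x i * s)   ≈⟨ +-congʳ (*-congˡ (+-congˡ Ai∙x)) ⟨
        x i * (deg i * x i + A i ∙ x) - (t * (x i * x i) + x i * s)     ≈⟨ +-congʳ (*-congˡ (Q-∙ i x)) ⟨
        x i * Q i ∙ x - (t * (x i * x i) + x i * s)                     ∎)
        (*-nonNegative (x≤y⇒0≤y-x (≤degree+2 i w rest)) (square-nonNegative (x i))))
        where
        -- Row `i` of `A` is 1 except at `i` and possibly at `w`, where `x` vanishes. On `x` it
        -- therefore acts like the row of J - I, with J the all-ones matrix.
        entry : ∀ j → A i j * x j ≈ x j + - 1# * (δ i j * x j)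
        entry j with δ-case i j | j ≟ w
        ... | inj₁ (≡.refl , δ≈1) | _ = ≈.trans (*-congʳ (A-nonEdge (adj-irrefl G i)))
          (≈.trans (solve 1 (λ x → con (+ 0) :* x := x :+ con -[1+ 0 ] :* (con (+ 1) :* x)) ≈.refl (x j))
            (+-congˡ (*-congˡ (*-congʳ (≈.sym δ≈1)))))
        ... | inj₂ (_ , δ≈0) | yes ≡.refl = ≈.trans (*-congˡ (vanishes w w∈))
          (≈.trans (solve 2 (λ a d → a :* con (+ 0) := con (+ 0) :+ con -[1+ 0 ] :* (d :* con (+ 0))) ≈.refl (A i j) (δ i j))
            (+-cong (≈.sym (vanishes w w∈)) (*-congˡ (*-congˡ (≈.sym (vanishes w w∈))))))
        ... | inj₂ (i≢j , δ≈0) | no j≢w = ≈.trans (*-congʳ (A-edge (rest j (i≢j ∘ ≡.sym) j≢w)))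
          (≈.trans (solve 1 (λ x → con (+ 1) :* x := x :+ con -[1+ 0 ] :* (con (+ 0) :* x)) ≈.refl (x j))
            (+-congˡ (*-congˡ (*-congʳ (≈.sym δ≈0)))))

        Ai∙x : A i ∙ x ≈ s - x i
        Ai∙x = begin
          A i ∙ x                                          ≈⟨ sum-cong-≋ entry ⟩
          (sum λ j → x j + - 1# * (δ i j * x j))           ≈⟨ ∑-distrib-+ x (λ j → - 1# * (δ i j * x j)) ⟩
          s + (sum λ j → - 1# * (δ i j * x j))             ≈⟨ +-congˡ (*-distribˡ-sum (- 1#) (λ j → δ i j * x j)) ⟨
          s + - 1# * δ i ∙ x                               ≈⟨ +-congˡ (*-congˡ (δ-∙ i x)) ⟩
          s + - 1# * x i                                   ≈⟨ solve 2 (λ s x → s :+ con -[1+ 0 ] :* x := s :- x) ≈.refl s (x i) ⟩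
          s - x i                                          ∎

  module _ {u z v : Fin n} (u≢z : u ≢ z) (u≢v : u ≢ v) (z≢v : z ≢ v) where

    -- The vector α (e_u - e_z) + β (e_v - e_z), written so that it agrees literally with the
    -- combination in `NegativePlane`.
    threePoint : Carrier → Carrier → Fin n → Carrier
    threePoint α β j = α * (δ u j - δ z j) + β * (δ v j - δ z j)

    threePoint-∙ : ∀ α β y → threePoint α β ∙ y ≈ α * y u + (β * y v - (α + β) * y z)
    threePoint-∙ α β y = begin
      threePoint α β ∙ y
        ≈⟨ ∙-cong {y = y} (λ j → solve 5 (λ a b p q r → a :* (p :- r) :+ b :* (q :- r) :=
             (con (+ 0) :+ a :* p) :+ b :* q :+ (:- (a :+ b)) :* r) ≈.refl α β (δ u j) (δ v j) (δ z j)) (λ _ → ≈.refl) ⟩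
      (λ j → (0# + α * δ u j) + β * δ v j + - (α + β) * δ z j) ∙ y
        ≈⟨ ∙-+*ˡ (λ j → (0# + α * δ u j) + β * δ v j) (- (α + β)) (δ z) y ⟩
      (λ j → (0# + α * δ u j) + β * δ v j) ∙ y + - (α + β) * δ z ∙ y
        ≈⟨ +-cong (∙-+*ˡ (λ j → 0# + α * δ u j) β (δ v) y) (*-congˡ (δ-∙ z y)) ⟩
      ((λ j → 0# + α * δ u j) ∙ y + β * δ v ∙ y) + - (α + β) * y z
        ≈⟨ +-congʳ (+-cong (∙-+*ˡ (λ _ → 0#) α (δ u) y) (*-congˡ (δ-∙ v y))) ⟩
      (((λ _ → 0#) ∙ y + α * δ u ∙ y) + β * y v) + - (α + β) * y z
        ≈⟨ +-congʳ (+-congʳ (+-cong (sum-zero (λ j → zeroˡ (y j))) (*-congˡ (δ-∙ u y)))) ⟩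
      ((0# + α * y u) + β * y v) + - (α + β) * y z
        ≈⟨ solve 5 (λ a b p q r → ((con (+ 0) :+ a :* p) :+ b :* q) :+ (:- (a :+ b)) :* r :=
             a :* p :+ (b :* q :- (a :+ b) :* r)) ≈.refl α β (y u) (y v) (y z) ⟩
      α * y u + (β * y v - (α + β) * y z)   ∎

    threePoint-u : ∀ α β → threePoint α β u ≈ α
    threePoint-u α β = ≈.trans
      (+-cong (*-congˡ (+-cong (δ-diagonal u) (-‿cong (δ-offDiagonal (u≢z ∘ ≡.sym)))))
              (*-congˡ (+-cong (δ-offDiagonal (u≢v ∘ ≡.sym)) (-‿cong (δ-offDiagonal (u≢z ∘ ≡.sym))))))
      (solve 2 (λ a b → a :* (con (+ 1) :- con (+ 0)) :+ b :* (con (+ 0) :- con (+ 0)) := a) ≈.refl α β)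

    threePoint-v : ∀ α β → threePoint α β v ≈ β
    threePoint-v α β = ≈.trans
      (+-cong (*-congˡ (+-cong (δ-offDiagonal u≢v) (-‿cong (δ-offDiagonal z≢v))))
              (*-congˡ (+-cong (δ-diagonal v) (-‿cong (δ-offDiagonal z≢v)))))
      (solve 2 (λ a b → a :* (con (+ 0) :- con (+ 0)) :+ b :* (con (+ 1) :- con (+ 0)) := b) ≈.refl α β)

    threePoint-z : ∀ α β → threePoint α β z ≈ - (α + β)
    threePoint-z α β = ≈.trans
      (+-cong (*-congˡ (+-cong (δ-offDiagonal u≢z) (-‿cong (δ-diagonal z))))
              (*-congˡ (+-cong (δ-offDiagonal (z≢v ∘ ≡.sym)) (-‿cong (δ-diagonal z)))))
      (solve 2 (λ a b → a :* (con (+ 0) :- con (+ 1)) :+ b :* (con (+ 0) :- con (+ 1)) := :- (a :+ b)) ≈.refl α β)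

    -- The form of Q - t at (α, β, γ), γ = -(α + β), is
    -- (deg u - 1 - t) α² + (deg v + 1 - t) β² + (deg z - 1 - t) γ².
    excess-threePoint : ∀ t → adj G u z ≡ true → adj G u v ≡ false → adj G z v ≡ false →
      deg u ≤ t → deg v + (1# + 1#) ≤ t → deg z ≤ t + 1# →
      ∀ α β → excess Q t (threePoint α β) ≤ - (α * α + β * β)
    excess-threePoint t u~z u≁v z≁v du dv dz α β = 0≤y-x⇒x≤y (≤-respʳ-≈ (≈.sym gap)
      (+-nonNegative (+-nonNegative (*-nonNegative (x≤y⇒0≤y-x du) (square-nonNegative α))
        (*-nonNegative (x≤y⇒0≤y-x dv) (square-nonNegative β)))
        (*-nonNegative (x≤y⇒0≤y-x dz) (square-nonNegative (α + β)))))
      where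
      w = threePoint α β

      Q-∙w : ∀ i {a b d} → Q i u ≈ a → Q i v ≈ b → Q i z ≈ d → Q i ∙ w ≈ α * a + (β * b - (α + β) * d)
      Q-∙w i iu iv iz = ≈.trans (∙-comm (Q i) w) (≈.trans (threePoint-∙ α β (Q i))
        (+-cong (*-congˡ iu) (+-cong (*-congˡ iv) (-‿cong (*-congˡ iz)))))

      form : w ∙ (λ i → Q i ∙ w) ≈ α * (α * deg u + (β * 0# - (α + β) * 1#)) +
        (β * (α * 0# + (β * deg v - (α + β) * 0#)) - (α + β) * (α * 1# + (β * 0# - (α + β) * deg z)))
      form = ≈.trans (threePoint-∙ α β (λ i → Q i ∙ w)) (+-cong
        (*-congˡ (Q-∙w u (Q-diagonal u) (Q-nonEdge u≢v u≁v) (Q-edge u≢z u~z)))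
        (+-cong
          (*-congˡ (Q-∙w v (Q-nonEdge (u≢v ∘ ≡.sym) (≡.trans (adj-sym G v u) u≁v)) (Q-diagonal v)
            (Q-nonEdge (z≢v ∘ ≡.sym) (≡.trans (adj-sym G v z) z≁v))))
          (-‿cong (*-congˡ (Q-∙w z (Q-edge (u≢z ∘ ≡.sym) (≡.trans (adj-sym G z u) u~z)) (Q-nonEdge z≢v z≁v) (Q-diagonal z))))))

      norm : w ∙ w ≈ α * α + (β * β - (α + β) * - (α + β))
      norm = ≈.trans (threePoint-∙ α β w) (+-cong (*-congˡ (threePoint-u α β))
        (+-cong (*-congˡ (threePoint-v α β)) (-‿cong (*-congˡ (threePoint-z α β)))))

      -- With γ = -(α + β), the edge uz contributes 2αγ = β² - α² - γ², which leaves only squares.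
      -- The three degree hypotheses say that the coefficients of α² and β² are at most -1 and that
      -- of γ² at most 0.
      gap : - (α * α + β * β) - excess Q t w ≈
        ((t - deg u) * (α * α) + (t - (deg v + (1# + 1#))) * (β * β)) + (t + 1# - deg z) * ((α + β) * (α + β))
      gap = ≈.trans (+-congˡ (-‿cong (+-cong form (-‿cong (*-congˡ norm)))))
        (solve 6 (λ a b t p q r →
          (:- (a :* a :+ b :* b)) :- ((a :* (a :* p :+ (b :* con (+ 0) :- (a :+ b) :* con (+ 1))) :+
            (b :* (a :* con (+ 0) :+ (b :* q :- (a :+ b) :* con (+ 0))) :-
             (a :+ b) :* (a :* con (+ 1) :+ (b :* con (+ 0) :- (a :+ b) :* r)))) :-
            t :* (a :* a :+ (b :* b :- (a :+ b) :* (:- (a :+ b))))) :=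
          ((t :- p) :* (a :* a) :+ (t :- (q :+ con (+ 2))) :* (b :* b)) :+ (t :+ con (+ 1) :- r) :* ((a :+ b) :* (a :+ b)))
          ≈.refl α β t (deg u) (deg v) (deg z))

-- The extremal graphs as complements of double stars.

open import Data.Nat using (_≤_)

distinct-true : ∀ {k} {x y : Fin k} → y ≢ x → distinct x y ≡ true
distinct-true {x = x} {y} y≢x with x ≟ y
... | yes x≡y = contradiction (≡.sym x≡y) y≢x
... | no _    = ≡.refl

-- The missing edges can be read off: v₂ misses only v₄ and v₃ only v₁; a clique vertex joined to
-- v₁, v₂, v₃ misses only v₄, one joined to v₂, v₃, v₄ only v₁. Allowing both kinds of clique vertex
-- treats the two families together.
pathWithClique-doubleStar : ∀ k (attach : Fin k → ℕ → Bool) →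
  (∀ x → (∀ j → attach x j ≡ near 2 j) ⊎ (∀ j → attach x j ≡ near 3 j)) →
  DoubleStarComplement (pathWithClique 4 k attach) (inj₁ zero) (inj₁ (suc (suc (suc zero))))
pathWithClique-doubleStar k attach near? = complement
  where
  v₁ v₄ : Fin 4 ⊎ Fin k
  v₁ = inj₁ zero
  v₄ = inj₁ (suc (suc (suc zero)))

  attach₂ : ∀ y → attach y 2 ≡ true
  attach₂ y with near? y
  ... | inj₁ eq = eq 2
  ... | inj₂ eq = eq 2

  attach₃ : ∀ y → attach y 3 ≡ true
  attach₃ y with near? y
  ... | inj₁ eq = eq 3
  ... | inj₂ eq = eq 3

  complement : DoubleStarComplement (pathWithClique 4 k attach) v₁ v₄
  complement (inj₁ zero)                   i≢v₁ _    = contradiction ≡.refl i≢v₁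
  complement (inj₁ (suc (suc (suc zero)))) _    i≢v₄ = contradiction ≡.refl i≢v₄
  complement (inj₁ (suc zero)) _ _ = v₄ , inj₂ ≡.refl , λ where
    (inj₁ zero)                   _   _    → ≡.refl
    (inj₁ (suc zero))             j≢i _    → contradiction ≡.refl j≢i
    (inj₁ (suc (suc zero)))       _   _    → ≡.refl
    (inj₁ (suc (suc (suc zero)))) _   j≢v₄ → contradiction ≡.refl j≢v₄
    (inj₂ y)                      _   _    → attach₂ y
  complement (inj₁ (suc (suc zero))) _ _ = v₁ , inj₁ ≡.refl , λ where
    (inj₁ zero)                   _   j≢v₁ → contradiction ≡.refl j≢v₁
    (inj₁ (suc zero))             _   _    → ≡.refl
    (inj₁ (suc (suc zero)))       j≢i _    → contradiction ≡.refl j≢i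
    (inj₁ (suc (suc (suc zero)))) _   _    → ≡.refl
    (inj₂ y)                      _   _    → attach₃ y
  complement (inj₂ x) _ _ with near? x
  ... | inj₁ eq = v₄ , inj₂ ≡.refl , λ where
    (inj₁ zero)                   _   _    → eq 1
    (inj₁ (suc zero))             _   _    → eq 2
    (inj₁ (suc (suc zero)))       _   _    → eq 3
    (inj₁ (suc (suc (suc zero)))) _   j≢v₄ → contradiction ≡.refl j≢v₄
    (inj₂ y)                      y≢x _    → distinct-true (y≢x ∘ ≡.cong inj₂)
  ... | inj₂ eq = v₁ , inj₁ ≡.refl , λ where
    (inj₁ zero)                   _   j≢v₁ → contradiction ≡.refl j≢v₁
    (inj₁ (suc zero))             _   _    → eq 2
    (inj₁ (suc (suc zero)))       _   _    → eq 3
    (inj₁ (suc (suc (suc zero)))) _   _    → eq 4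
    (inj₂ y)                      y≢x _    → distinct-true (y≢x ∘ ≡.cong inj₂)

G-single-doubleStar : ∀ n → ∃₂ (DoubleStarComplement (G-single n 3 2))
G-single-doubleStar n = _ , _ , pathWithClique-doubleStar (n ∸ 4) (λ _ → near 2) (λ _ → inj₁ λ _ → ≡.refl)

G-split-doubleStar : ∀ n a → ∃₂ (DoubleStarComplement (G-split n 3 2 a))
G-split-doubleStar n a = _ , _ , pathWithClique-doubleStar (n ∸ 4) attach near?
  where
  attach : Fin (n ∸ 4) → ℕ → Bool
  attach x = if toℕ x <ᵇ a then near 2 else near 3

  near? : ∀ x → (∀ j → attach x j ≡ near 2 j) ⊎ (∀ j → attach x j ≡ near 3 j)
  near? x with toℕ x <ᵇ a
  ... | true  = inj₁ λ _ → ≡.refl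
  ... | false = inj₂ λ _ → ≡.refl

≅-doubleStar : {V W : Set} {G : Graph V} {H : Graph W} → G ≅ H →
  ∃₂ (DoubleStarComplement H) → ∃₂ (DoubleStarComplement G)
≅-doubleStar {V} {W} {G} {H} (f , adj≡) (u , v , H-complement) = from u , from v , complement
  where
  open Inverse f using (to; from; strictlyInverseʳ)

  to-≢ : ∀ {i w} → i ≢ from w → to i ≢ w
  to-≢ {i} i≢ eq = i≢ (≡.trans (≡.sym (strictlyInverseʳ i)) (≡.cong from eq))

  to-injective-≢ : ∀ {i j} → j ≢ i → to j ≢ to i
  to-injective-≢ {i} j≢i = to-≢ λ eq → j≢i (≡.trans eq (strictlyInverseʳ i))

  complement : DoubleStarComplement G (from u) (from v)
  complement i i≢u i≢v with H-complement (to i) (to-≢ i≢u) (to-≢ i≢v)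
  ... | w , w∈ , rest = from w , from-∈ w∈ , λ j j≢i j≢w →
          ≡.trans (adj≡ i j) (rest (to j) (to-injective-≢ j≢i) (to-≢ j≢w))
    where
    from-∈ : w ≡ u ⊎ w ≡ v → from w ≡ from u ⊎ from w ≡ from v
    from-∈ (inj₁ eq) = inj₁ (≡.cong from eq)
    from-∈ (inj₂ eq) = inj₂ (≡.cong from eq)

-- Geodesics of length 3.

-- Minimality of the walk is turned into adjacency values. The list is stable under exchanging the
-- ends: `u≁y` and `x≁v` change places.
record GeodesicOfLength3 {V : Set} (G : Graph V) (u x y v : V) : Set where
  field
    u~x : adj G u x ≡ true
    x~y : adj G x y ≡ true
    y~v : adj G y v ≡ true
    u≢v : u ≢ v
    u≁v : adj G u v ≡ false
    u≁y : adj G u y ≡ false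
    x≁v : adj G x v ≡ false
    noCommonNeighbour : ∀ j → adj G u j ≡ true → adj G v j ≡ false

≡true⇒T : ∀ {b} → b ≡ true → T b
≡true⇒T ≡.refl = tt

T⇒≡true : ∀ {b} → T b → b ≡ true
T⇒≡true {true} _ = ≡.refl

¬T⇒≡false : ∀ {b} → ¬ T b → b ≡ false
¬T⇒≡false {true}  ¬t = contradiction tt ¬t
¬T⇒≡false {false} _  = ≡.refl

-- Equal or adjacent ends, a chord, or a common neighbour would each give a walk of length at most
-- 2.
distance3⇒geodesic : {V : Set} {G : Graph V} {u v : V} → Distance G u v 3 → ∃₂ λ x y → GeodesicOfLength3 G u x y v
distance3⇒geodesic {G = G} {u} {v} (_∷_ {v = x} ux (_∷_ {v = y} xy (yv ∷ [])) , minimal) = x , y , record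
  { u~x = T⇒≡true ux ; x~y = T⇒≡true xy ; y~v = T⇒≡true yv
  ; u≢v = λ { ≡.refl → contradiction (minimal 0 []) λ () }
  ; u≁v = ¬T⇒≡false λ uv → contradiction (minimal 1 (uv ∷ [])) λ { (s≤s ()) }
  ; u≁y = ¬T⇒≡false λ uy → noWalk2 uy yv
  ; x≁v = ¬T⇒≡false λ xv → noWalk2 ux xv
  ; noCommonNeighbour = λ j uj → ¬T⇒≡false λ vj → noWalk2 (≡true⇒T uj) (≡.subst T (adj-sym G v j) vj)
  }
  where
  noWalk2 : ∀ {j} → T (adj G u j) → ¬ T (adj G j v)
  noWalk2 uj jv = contradiction (minimal 2 (uj ∷ jv ∷ [])) λ { (s≤s (s≤s ())) }

-- This is the symmetry that allows the end of small degree to be called `v`.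
reverse : {V : Set} {G : Graph V} {u x y v : V} → GeodesicOfLength3 G u x y v → GeodesicOfLength3 G v y x u
reverse {G = G} {u} {x} {y} {v} P = record
  { u~x = ≡.trans (adj-sym G v y) y~v ; x~y = ≡.trans (adj-sym G y x) x~y ; y~v = ≡.trans (adj-sym G x u) u~x
  ; u≢v = u≢v ∘ ≡.sym
  ; u≁v = ≡.trans (adj-sym G v u) u≁v ; u≁y = ≡.trans (adj-sym G v x) x≁v ; x≁v = ≡.trans (adj-sym G y u) u≁y
  ; noCommonNeighbour = λ j v~j → ¬T⇒≡false λ uj →
      contradiction (≡.trans (≡.sym v~j) (noCommonNeighbour j (T⇒≡true uj))) λ ()
  }
  where open GeodesicOfLength3 P

≢-byAdjacency : {V : Set} (G : Graph V) {i j k : V} → adj G i j ≡ true → adj G i k ≡ false → j ≢ k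
≢-byAdjacency G i~j i≁k ≡.refl = contradiction (≡.trans (≡.sym i~j) i≁k) λ ()

-- Eigenvalues below n - 3.

module _ {c ℓ₁ ℓ₂} (𝔽 : OrderedField c ℓ₁ ℓ₂) {k : ℕ} (G : Graph (Fin (3 ℕ.+ k))) where
  open OrderedFieldProperties 𝔽 using (fromℕ; _<_; ≮⇒≥; fromℕ-mono-≤; fromℕ-+; ≤-respʳ-≈; ≤-respˡ-≈; δ;
    _≤?_; _<?_; +-identityʳ; +-congˡ; +-comm; solve; _:=_; _:+_; con; module ≈)
  open OrderedField 𝔽 using (_≈_; 0#; 1#; _+_; _-_; _*_; -_; Carrier) renaming (_≤_ to _⊑_)
  open SymmetricMatrices 𝔽
  open Inertia 𝔽
  open SignlessLaplacian 𝔽 G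

  private
    -- With n written as 3 + k, the truncated difference `n ∸ 3` computes to `k`, so this is the end
    -- point of the interval by definition.
    t : Carrier
    t = fromℕ k

  -- Vanishing at the two centres amounts to two linear conditions, which three eigenvectors below
  -- `t` would be too many for.
  fewBelow : ∃₂ (DoubleStarComplement G) → {μs : Fin 3 → Carrier} → OrthogonalEigenvectors Q μs → ¬ (∀ i → μs i < t)
  fewBelow (u , v , complement) E = fewEigenvaluesBelow Q-symmetric E t l λ x l∙x≈0 →
    excess-doubleStar n≈t+3 complement x
      (≈.trans (≈.sym (δ-∙ u x)) (l∙x≈0 zero)) (≈.trans (≈.sym (δ-∙ v x)) (l∙x≈0 (suc zero)))
    where
    open OrderedFieldProperties 𝔽 using (δ-∙)
    l : Fin 2 → Fin (3 ℕ.+ k) → Carrier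
    l zero       = δ u
    l (suc zero) = δ v

    n≈t+3 : fromℕ (3 ℕ.+ k) ≈ t + (1# + 1# + 1#)
    n≈t+3 = solve 1 (λ t → con (+ 1) :+ (con (+ 1) :+ (con (+ 1) :+ t)) := t :+ con (+ 3)) ≈.refl t

  -- The degree bounds come from non-neighbours: u misses u, v, y, so deg u ≤ n - 3 = t; x misses x
  -- and v, so deg x ≤ n - 2 = t + 1. The hypothesis on v says deg v + 2 ≤ t.
  geodesic-negativePlane : ∀ {u x y v} (P : GeodesicOfLength3 G u x y v) → degree G v ℕ.+ 5 ≤ 3 ℕ.+ k →
    NegativePlane Q t
  geodesic-negativePlane {u} {x} {y} {v} P dv = (λ j → δ u j - δ x j) , (λ j → δ v j - δ x j) , excess-threePoint u≢x u≢v x≢v t u~x u≁v x≁v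
    (fromℕ-mono-≤ {degree G u} {k} (ℕₚ.+-cancelʳ-≤ 3 _ _ (≡.subst (degree G u ℕ.+ 3 ≤_) (ℕₚ.+-comm 3 k)
      (degree+nonNeighbours≤ u f f-injective f-nonAdjacent))))
    (≤-respˡ-≈ (≈.trans (fromℕ-+ (degree G v) 2) (+-congˡ (+-congˡ (+-identityʳ 1#))))
      (fromℕ-mono-≤ {degree G v ℕ.+ 2} {k} (ℕₚ.+-cancelʳ-≤ 3 _ _
        (≡.subst₂ _≤_ (≡.sym (ℕₚ.+-assoc (degree G v) 2 3)) (ℕₚ.+-comm 3 k) dv))))
    (≤-respʳ-≈ (+-comm 1# t) (fromℕ-mono-≤ {degree G x} {suc k} (ℕₚ.+-cancelʳ-≤ 2 _ _
      (≡.subst (degree G x ℕ.+ 2 ≤_) (≡.cong suc (ℕₚ.+-comm 2 k)) (degree+nonNeighbours≤ x g g-injective g-nonAdjacent)))))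
    where
    open GeodesicOfLength3 P

    u≢x : u ≢ x
    u≢x = ≢-byAdjacency G u~x (adj-irrefl G u) ∘ ≡.sym

    x≢v : x ≢ v
    x≢v = ≢-byAdjacency G u~x u≁v

    y≢u : y ≢ u
    y≢u = ≢-byAdjacency G (≡.trans (adj-sym G v y) y~v) (≡.trans (adj-sym G v u) u≁v)

    y≢v : y ≢ v
    y≢v = ≢-byAdjacency G x~y x≁v

    f : Fin 3 → Fin (3 ℕ.+ k)
    f zero             = u
    f (suc zero)       = v
    f (suc (suc zero)) = y

    f-injective : Injective _≡_ _≡_ f
    f-injective {zero}           {zero}           _  = ≡.refl
    f-injective {zero}           {suc zero}       eq = contradiction eq u≢v
    f-injective {zero}           {suc (suc zero)} eq = contradiction (≡.sym eq) y≢u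
    f-injective {suc zero}       {zero}           eq = contradiction (≡.sym eq) u≢v
    f-injective {suc zero}       {suc zero}       _  = ≡.refl
    f-injective {suc zero}       {suc (suc zero)} eq = contradiction (≡.sym eq) y≢v
    f-injective {suc (suc zero)} {zero}           eq = contradiction eq y≢u
    f-injective {suc (suc zero)} {suc zero}       eq = contradiction eq y≢v
    f-injective {suc (suc zero)} {suc (suc zero)} _  = ≡.refl

    f-nonAdjacent : ∀ i → adj G u (f i) ≡ false
    f-nonAdjacent zero             = adj-irrefl G u
    f-nonAdjacent (suc zero)       = u≁v
    f-nonAdjacent (suc (suc zero)) = u≁y

    g : Fin 2 → Fin (3 ℕ.+ k)
    g zero       = x
    g (suc zero) = v

    g-injective : Injective _≡_ _≡_ g
    g-injective {zero}     {zero}     _  = ≡.refl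
    g-injective {zero}     {suc zero} eq = contradiction eq x≢v
    g-injective {suc zero} {zero}     eq = contradiction (≡.sym eq) x≢v
    g-injective {suc zero} {suc zero} _  = ≡.refl

    g-nonAdjacent : ∀ i → adj G x (g i) ≡ false
    g-nonAdjacent zero       = adj-irrefl G x
    g-nonAdjacent (suc zero) = x≁v

  someDegree+5≤ : 7 ≤ 3 ℕ.+ k → ∀ {d e} → (d ℕ.+ e) ℕ.+ 2 ≤ 3 ℕ.+ k → d ℕ.+ 5 ≤ 3 ℕ.+ k ⊎ e ℕ.+ 5 ≤ 3 ℕ.+ k
  someDegree+5≤ 7≤n {d} {e} d+e+2≤n with d ℕ.+ 5 ℕ.≤? 3 ℕ.+ k | e ℕ.+ 5 ℕ.≤? 3 ℕ.+ k
  ... | yes p | _     = inj₁ p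
  ... | no _  | yes q = inj₂ q
  ... | no ¬p | no ¬q = contradiction (begin-strict
    -- Both degrees are at least n - 4. The extra summand n on both sides avoids subtraction, and
    -- `7≤n` makes the first comparison strict.
    n ℕ.+ n ℕ.+ 6                               <⟨ ℕₚ.+-monoʳ-< (n ℕ.+ n) 7≤n ⟩
    n ℕ.+ n ℕ.+ n                               ≤⟨ ℕₚ.+-monoˡ-≤ n (ℕₚ.+-mono-≤ (n≤+4 d ¬p) (n≤+4 e ¬q)) ⟩
    d ℕ.+ 4 ℕ.+ (e ℕ.+ 4) ℕ.+ n                 ≡⟨ rearrange d e n ⟩
    n ℕ.+ ((d ℕ.+ e) ℕ.+ 2) ℕ.+ 6               ≤⟨ ℕₚ.+-monoˡ-≤ 6 (ℕₚ.+-monoʳ-≤ n d+e+2≤n) ⟩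
    n ℕ.+ n ℕ.+ 6                               ∎) (ℕₚ.<-irrefl ≡.refl)
    where
    open ℕₚ.≤-Reasoning
    n = 3 ℕ.+ k
    n≤+4 : ∀ a → ¬ a ℕ.+ 5 ≤ n → n ≤ a ℕ.+ 4
    n≤+4 a a+5≰n = ℕₚ.≤-pred (≡.subst (suc n ≤_) (ℕₚ.+-suc a 4) (ℕₚ.≰⇒> a+5≰n))
    rearrange : ∀ d e n → d ℕ.+ 4 ℕ.+ (e ℕ.+ 4) ℕ.+ n ≡ n ℕ.+ ((d ℕ.+ e) ℕ.+ 2) ℕ.+ 6
    rearrange = solve-∀

  someTwoBelow : 7 ≤ 3 ℕ.+ k → ∀ {u v} → Distance G u v 3 →
    {μs : Fin (3 ℕ.+ k) → Carrier} → OrthogonalEigenvectors Q μs → ∀ p → ¬ (∀ i → i ≢ p → t ⊑ μs i)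
  someTwoBelow 7≤n {u} {v} dist E p with distance3⇒geodesic {G = G} dist
  ... | x , y , P = twoBelow (someDegree+5≤ 7≤n (degrees+2≤ u v u≢v u≁v noCommonNeighbour))
    where
    open GeodesicOfLength3 P
    twoBelow : degree G u ℕ.+ 5 ≤ 3 ℕ.+ k ⊎ degree G v ℕ.+ 5 ≤ 3 ℕ.+ k → _
    twoBelow (inj₁ du) = twoEigenvaluesBelow Q-symmetric E t (geodesic-negativePlane (reverse {G = G} P) du) p
    twoBelow (inj₂ dv) = twoEigenvaluesBelow Q-symmetric E t (geodesic-negativePlane P dv) p

  module _ (S : Spectrum 𝔽 G) where
    open Spectrum S

    private
      E : OrthogonalEigenvectors Q (lookup eigenvalues)
      E = spectral Q Q-symmetric eigenvalues isSpectrum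

      open OrthogonalEigenvectors E
      open Counting (λ μ → (fromℕ 0 ≤? μ) ×-dec (μ <? t))

    m≥2 : 7 ≤ 3 ℕ.+ k → HasDiameter G 3 → 2 ≤ m 𝔽 S (fromℕ 0) t
    m≥2 7≤n (_ , u , v , dist) with 2 ℕ.≤? m 𝔽 S (fromℕ 0) t
    ... | yes 2≤m = 2≤m
    ... | no  2≰m = let p , none = count≤1⇒allButOne eigenvalues (ℕₚ.≤-pred (ℕₚ.≰⇒> 2≰m)) in
      contradiction
        -- An uncounted eigenvalue could also be negative; positive semidefiniteness of Q rules this
        -- out, so it is at least `t`.
        (λ i i≢p → ≮⇒≥ λ μᵢ<t → none i i≢p (eigenvalue-nonNegative {M = Q} Q-nonNegative (nonZero i) (eigenvector i) , μᵢ<t))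
        (someTwoBelow 7≤n dist E p)

    m≤2 : ∃₂ (DoubleStarComplement G) → m 𝔽 S (fromℕ 0) t ≤ 2
    m≤2 doubleStar with m 𝔽 S (fromℕ 0) t ℕ.≤? 2
    ... | yes m≤2 = m≤2
    ... | no  m≰2 = let f , f-injective , below = count≥⇒injection eigenvalues 3 (ℕₚ.≰⇒> m≰2) in
      contradiction (proj₂ ∘ below) (fewBelow doubleStar (restrict f f-injective E))

theorem3p5 : ∀ {c ℓ₁ ℓ₂} (𝔽 : OrderedField c ℓ₁ ℓ₂) (n : ℕ) (G : Graph (Fin n)) (S : Spectrum 𝔽 G) →
    7 ≤ n → Connected G → HasDiameter G 3 →
    let open OrderedField 𝔽 using (fromℕ) in
    (2 ≤ m 𝔽 S (fromℕ 0) (fromℕ (n ∸ 3))) ×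
    ((G ≅ G-single n 3 2 ⊎ (∃ λ a → (1 ≤ a) × (a ≤ n ∸ 5) × (G ≅ G-split n 3 2 a))) →
    m 𝔽 S (fromℕ 0) (fromℕ (n ∸ 3)) ≡ 2)
theorem3p5 𝔽 n@(suc (suc (suc k))) G S 7≤n _ diameter = 2≤m , λ extremal → ℕₚ.≤-antisym (m≤2 𝔽 {k} G S (doubleStar extremal)) 2≤m
  where
  2≤m = m≥2 𝔽 {k} G S 7≤n diameter

  doubleStar : (G ≅ G-single n 3 2 ⊎ (∃ λ a → (1 ≤ a) × (a ≤ n ∸ 5) × (G ≅ G-split n 3 2 a))) → ∃₂ (DoubleStarComplement G)
  doubleStar (inj₁ G≅single)              = ≅-doubleStar {G = G} {G-single n 3 2} G≅single (G-single-doubleStar n)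
  doubleStar (inj₂ (a , _ , _ , G≅split)) = ≅-doubleStar {G = G} {G-split n 3 2 a} G≅split (G-split-doubleStar n a)
theorem3p5 𝔽 (suc zero)       G S (s≤s ()) _ _
theorem3p5 𝔽 (suc (suc zero)) G S (s≤s (s≤s ())) _ _
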